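{- For each integer $k>1$ let $j(\alpha^k)=k-1$ and $j(\alpha^{i-1})=i$ for $i=k-1,\ldots,1$. Then: (A) each column $\alpha^{i-1}$ in $\mathrm{CAT}(k)$, for $i\in\{1,\ldots,k-1\}\cup\{k+1\}$, preserves the respective $j(\alpha^{i-1})$-th entry of $\alpha$; that is, for every $k$-germ $\alpha$, the entries of $\alpha$ and of $\alpha^{i-1}$ at position $j(\alpha^{i-1})$ are equal; (B) the columns $\alpha^k$ of all the tables $\mathrm{CAT}(k)$, $k>1$, coincide into one sequence of restricted-growth strings and thus into one integer sequence $\mathcal{S}_0$ (that is, for each $k$ the column $\alpha^k$ of $\mathrm{CAT}(k)$, written via indices in the natural enumeration, consists of the first $C_k$ terms of $\mathcal{S}_0$), and for each $k$ the first $C_k$ terms of $\mathcal{S}_0$ form a permutation of $\{0,\ldots,C_k-1\}$ whose square is the identity; (C) let $\mathcal{S}_1$ be the integer sequence given by concatenating the parts with row indices $m$ in the intervals $[0,2),[2,5),\ldots,[C_{k-1},C_k),\ldots$ of the columns $\alpha^{k-1}$ of the corresponding tables $\mathrm{CAT}(2),\mathrm{CAT}(3),\ldots,\mathrm{CAT}(k),\ldots$; then $\mathcal{S}_1$ encodes all the columns $\alpha^{k-1}$, in the sense that for each $k>2$ the whole column $\alpha^{k-1}$ of $\mathrm{CAT}(k)$ is determined, as a permutation of $\{0,\ldots,C_k-1\}$ whose square is the identity, by its part with $m\in[C_{k-1},C_k)$ (for $k=2$ the part $[0,2)$ is the whole column); (D) for each $k>1$, the column $\alpha^{k-1}$ of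 $\mathrm{CAT}(k)$ gives a permutation of $\{0,\ldots,C_k-1\}$ whose square is the identity, and this permutation equals the one given by the rows $m\in[0,C_k)$ of the column $\alpha^{k-1}$ of $\mathrm{CAT}(k+1)$.
   Context: $k$-germs. For $k>1$, a $k$-germ is a $(k-1)$-string $\alpha=a_{k-1}a_{k-2}\cdots a_1$ of nonnegative integers with $a_{k-1}\in\{0,1\}$ and $0\le a_{i-1}\le a_i+1$ for $1<i<k$; $a_j$ is the entry at position $j$. There are $C_k=\frac{(2k)!}{k!(k+1)!}$ $k$-germs. They are ordered lexicographically from the left ($\alpha<\beta$ iff at the leftmost position where they differ the entry of $\alpha$ is smaller); the natural enumeration writes them as $\alpha(0)<\alpha(1)<\cdots<\alpha(C_k-1)$. Prefixing a $0$ to a $k$-germ gives a $(k+1)$-germ with the same index $m$. Stripping the leading zeros of a $k$-germ (keeping $0$ for the null germ) gives its restricted-growth string (RGS). $F$. For $\alpha\ne0^{k-1}$ with rightmost nonzero entry $a_i$, $\beta(\alpha)$ is obtained from $\alpha$ by replacing $a_i$ by $a_i-1$. $F(\alpha)$ is the string of length $n=2k+1$ with entries $0,1,\ldots,k$ (once each) and $k$ asterisks defined by: $F(0^{k-1})=01\cdots k*\cdots*$; if $\alpha\ne 0^{k-1}$ has rightmost nonzero entry $a_i$, write $F(\beta(\alpha))=W|X|Y|Z$ with $W,Z$ its initial and terminal substrings of length $i$, $\Omega$ the first entry of $X$, and $Y$ starting at the entry $\Omega+1$; then $F(\alpha)=W|Y|X|Z$. Let $\theta(\alpha)$ be the binary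 $n$-string obtained from $F(\alpha)$ by replacing each number by $0$ and each asterisk by $1$; every binary $n$-string of weight $k$ is a cyclic translate of $\theta(\alpha)$ for exactly one $k$-germ $\alpha$. Neighbors $\alpha^p$ and tables. For $p\in\{0,1,\ldots,k\}$, $\alpha^p$ is the neighbor of $\alpha$ via color $p$ in the graph $R_k$ (dihedral quotient of the middle-levels graph): change from $0$ to $1$ the entry of $\theta(\alpha)$ at the position where $F(\alpha)$ has the number $p$; take the complemented reversal $b_0\cdots b_{2k}\mapsto\bar b_{2k}\cdots\bar b_0$ of the result, which has weight $k$; $\alpha^p$ is the unique $k$-germ such that this string is a cyclic translate of $\theta(\alpha^p)$. The colored adjacency table $\mathrm{CAT}(k)$ has rows indexed by $m=0,\ldots,C_k-1$ with $\alpha=\alpha(m)$, and columns $\alpha^k,\alpha^{k-1},\ldots,\alpha^0$. A column is regarded as an integer sequence by replacing each $k$-germ by its index in the natural enumeration. -}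

module Defs where

open import Data.Bool.Base using (Bool; true; false; not; _∨_)
open import Data.Fin.Base using (Fin; zero; suc; toℕ; cast; fromℕ<)
open import Data.Fin.Permutation using (Permutation′; _⟨$⟩ʳ_; _∘ₚ_; _≈_; id)
open import Data.Fin.Properties using (any?; toℕ≤pred[n]; toℕ-fromℕ<)
open import Data.List.Base as List
  using (List; []; _∷_; _++_; concat; length; take; drop; upTo; tabulate; find; break; dropWhile; reverse)
open import Data.List.Membership.Propositional using (_∈_)
open import Data.List.Membership.Propositional.Properties using (∈-map⁺; ∈-concat⁺′; ∈-tabulate⁺)
open import Data.List.Properties as Listₚ using (length-++; length-map)
open import Data.List.Relation.Unary.All as All using (All)
import Data.List.Relation.Unary.All.Properties as All
open import Data.List.Relation.Unary.AllPairs as AllPairs using (AllPairs)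
import Data.List.Relation.Unary.AllPairs.Properties as AllPairs
open import Data.List.Relation.Unary.Any using (here; index)
open import Data.Maybe.Base using (Maybe; just; nothing; fromMaybe)
import Data.Maybe.Properties as Maybeₚ
open import Data.Nat.Base
  using (ℕ; zero; suc; _+_; _*_; _∸_; _≤_; _<_; z≤n; s≤s; _!; NonZero)
open import Data.Nat.Combinatorics
  using (nCk≡n!/k![n-k]!; nCk≡nC[n∸k]; nCk+nC[k+1]≡[n+1]C[k+1]; k![n∸k]!∣n!) renaming (_C_ to infixl 7.5 _choose_)
open import Data.Nat.DivMod using (_/_; m*n/n≡m; m/n*n≡m)
open import Data.Nat.Properties
open import Data.Nat.Solver using (module +-*-Solver)
open import Data.Product.Base using (Σ-syntax; ∃; _×_; _,_)
open import Data.Vec.Base as Vec using (Vec; []; _∷_; toList)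
open import Data.Vec.Relation.Binary.Lex.Strict using (Lex-<; this; next)
open import Function.Base using (_∘_)
open import Relation.Binary.Definitions using (DecidableEquality)
open import Relation.Binary.PropositionalEquality
open import Relation.Nullary.Decidable using (Dec; yes; no; does)

import Data.Bool.Properties as Boolₚ

catalan : ℕ → ℕ
catalan k = ((2 * k) !) / (k ! * suc k !)
  where instance
    nz : NonZero (k ! * suc k !)
    nz = k !* suc k !≢0

-- Strings are written from left to right, a_{k-1} ⋯ a₁, so that the head of
-- a vector of length i is its entry at position i.

data Restricted (b : ℕ) : ∀ {n} → Vec ℕ n → Set where
  []  : Restricted b []
  _∷_ : ∀ {n a} {as : Vec ℕ n} →
        a ≤ b → Restricted (suc a) as → Restricted b (a ∷ as)

record RestrictedString (b n : ℕ) : Set where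
  constructor _,_
  field
    string     : Vec ℕ n
    restricted : Restricted b string

open RestrictedString public

Germ : ℕ → Set
Germ k = RestrictedString 1 (k ∸ 1)

-- The value outside the range 1 ≤ j ≤ n is irrelevant.
entry : ∀ {n} → Vec ℕ n → ℕ → ℕ
entry []                 j = 0
entry (_∷_ {n} a as) j with j ≟ suc n
... | yes _ = a
... | no  _ = entry as j

rgs : ∀ {b n} → RestrictedString b n → List ℕ
rgs α with dropWhile (_≟ 0) (toList (string α))
... | []     = 0 ∷ []
... | a ∷ as = a ∷ as

zeros : ∀ b n → RestrictedString b n
zeros b zero    = [] , []
zeros b (suc n) = let (α , r) = zeros 1 n in (0 ∷ α) , (z≤n ∷ r)

nullGerm : ∀ k → Germ k
nullGerm k = zeros 1 (k ∸ 1)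

infix 4 _<ₗₑₓ_
_<ₗₑₓ_ : ∀ {b n} → RestrictedString b n → RestrictedString b n → Set
(α , _) <ₗₑₓ (β , _) = Lex-< _≡_ _<_ α β

prefix : ∀ {b n} (a : Fin (suc b)) → RestrictedString (suc (toℕ a)) n → RestrictedString b (suc n)
prefix a (as , r) = (toℕ a ∷ as) , (toℕ≤pred[n] a ∷ r)

restrictedStrings : ∀ b n → List (RestrictedString b n)
restrictedStringsFrom : ∀ {b} n → Fin (suc b) → List (RestrictedString b (suc n))

restrictedStrings b zero    = ([] , []) ∷ []
restrictedStrings b (suc n) = concat (tabulate {n = suc b} (restrictedStringsFrom n))

restrictedStringsFrom n a = List.map (prefix a) (restrictedStrings (suc (toℕ a)) n)

germs : ∀ k → List (Germ k)
germs k = restrictedStrings 1 (k ∸ 1)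

restrictedStrings-sorted : ∀ b n → AllPairs _<ₗₑₓ_ (restrictedStrings b n)
restrictedStrings-sorted b zero    = All.[] AllPairs.∷ AllPairs.[]
restrictedStrings-sorted b (suc n) = AllPairs.concat⁺
  (All.tabulate⁺ {f = restrictedStringsFrom n} λ a → AllPairs.map⁺
    (AllPairs.map (next refl) (restrictedStrings-sorted (suc (toℕ a)) n)))
  (AllPairs.tabulate⁺-< {f = restrictedStringsFrom n} λ a<a′ →
    All.map⁺ (All.universal (λ _ → All.map⁺ (All.universal (λ _ → this a<a′ refl) _)) _))

germs-sorted : ∀ k → AllPairs _<ₗₑₓ_ (germs k)
germs-sorted k = restrictedStrings-sorted 1 (k ∸ 1)

restricted-irrelevant : ∀ {b n} {α : Vec ℕ n} (r s : Restricted b α) → r ≡ s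
restricted-irrelevant []      []      = refl
restricted-irrelevant (p ∷ r) (q ∷ s) =
  cong₂ _∷_ (≤-irrelevant p q) (restricted-irrelevant r s)

restrictedStrings-complete : ∀ {b n} (α : RestrictedString b n) → α ∈ restrictedStrings b n
restrictedStrings-complete ([] , []) = here refl
restrictedStrings-complete {b} {suc n} ((a ∷ as) , (a≤b ∷ r)) =
  ∈-concat⁺′ (go (toℕ-fromℕ< (s≤s a≤b)) a≤b r) (∈-tabulate⁺ {f = restrictedStringsFrom n} (fromℕ< (s≤s a≤b)))
  where
  go : ∀ {i : Fin (suc b)} {a} {as : Vec ℕ n} → toℕ i ≡ a →
       (p : a ≤ b) (r : Restricted (suc a) as) →
       ((a ∷ as) , (p ∷ r)) ∈ restrictedStringsFrom n i
  go {i} refl p r = subst (λ p → (_ , (p ∷ r)) ∈ _) (≤-irrelevant _ p)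
    (∈-map⁺ (prefix i) (restrictedStrings-complete (_ , r)))

germs-complete : ∀ k (α : Germ k) → α ∈ germs k
germs-complete k = restrictedStrings-complete

private
  count : ℕ → ℕ → ℕ
  count b n = length (restrictedStrings b n)

  Σ< : ℕ → (ℕ → ℕ) → ℕ
  Σ< zero    f = 0
  Σ< (suc n) f = f 0 + Σ< n (f ∘ suc)

  Σ<-last : ∀ n f → Σ< (suc n) f ≡ Σ< n f + f n
  Σ<-last zero    f = +-comm (f 0) 0
  Σ<-last (suc n) f = trans (cong (f 0 +_) (Σ<-last n (f ∘ suc))) (sym (+-assoc (f 0) _ _))

  length-concat-tabulate : ∀ {A : Set} n (xs : Fin n → List A) (f : ℕ → ℕ) →
    (∀ i → length (xs i) ≡ f (toℕ i)) → length (concat (tabulate xs)) ≡ Σ< n f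
  length-concat-tabulate zero    xs f eq = refl
  length-concat-tabulate (suc n) xs f eq = trans (length-++ (xs zero))
    (cong₂ _+_ (eq zero) (length-concat-tabulate n (xs ∘ suc) (f ∘ suc) (eq ∘ suc)))

  count-Σ : ∀ b n → count b (suc n) ≡ Σ< (suc b) (λ a → count (suc a) n)
  count-Σ b n = length-concat-tabulate (suc b)
    (restrictedStringsFrom n) (λ a → count (suc a) n)
    (λ a → length-map (prefix a) (restrictedStrings (suc (toℕ a)) n))

  count-zero : ∀ n → count 0 (suc n) ≡ count 1 n
  count-zero n = trans (count-Σ 0 n) (+-identityʳ _)

  count-suc : ∀ b n → count (suc b) (suc n) ≡ count b (suc n) + count (2 + b) n
  count-suc b n = trans (count-Σ (suc b) n)
    (trans (Σ<-last (suc b) (λ a → count (suc a) n)) (cong (_+ count (2 + b) n) (sym (count-Σ b n))))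

  -- m choose (j - 1)
  below : ℕ → ℕ → ℕ
  below m zero    = 0
  below m (suc j) = m choose j

  below-pascal : ∀ m j → below m j + m choose j ≡ suc m choose j
  below-pascal m zero    = refl
  below-pascal m (suc j) = nCk+nC[k+1]≡[n+1]C[k+1] m j

  -- Ballot numbers: count b n = C(2n+b, n) - C(2n+b, n-1).
  count-ballot : ∀ b n → count b n + below (n + n + b) n ≡ (n + n + b) choose n
  count-ballot b       zero    = refl
  count-ballot zero    (suc n) = begin
    count 0 (suc n) + (suc n + suc n + 0) choose n
      ≡⟨ cong₂ _+_ (count-zero n) (cong (_choose n) shape) ⟩
    count 1 n + suc m choose n            ≡⟨ cong (count 1 n +_) (sym (below-pascal m n)) ⟩
    count 1 n + (below m n + m choose n)  ≡⟨ sym (+-assoc (count 1 n) _ _) ⟩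
    count 1 n + below m n + m choose n    ≡⟨ cong (_+ m choose n) (count-ballot 1 n) ⟩
    m choose n + m choose n               ≡⟨ cong (m choose n +_) middle ⟩
    m choose n + m choose suc n           ≡⟨ nCk+nC[k+1]≡[n+1]C[k+1] m n ⟩
    suc m choose suc n                    ≡⟨ cong (_choose suc n) (sym shape) ⟩
    (suc n + suc n + 0) choose suc n      ∎
    where
    open ≡-Reasoning
    open +-*-Solver
    m = n + n + 1
    shape : suc n + suc n + 0 ≡ suc m
    shape = solve 1 (λ n → con 1 :+ n :+ (con 1 :+ n) :+ con 0 := con 1 :+ (n :+ n :+ con 1)) refl n
    split : m ≡ suc n + n
    split = +-comm (n + n) 1
    middle : m choose n ≡ m choose suc n
    middle = trans (nCk≡nC[n∸k] (≤-trans (m≤n+m n (suc n)) (≤-reflexive (sym split))))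
      (cong (m choose_) (trans (cong (_∸ n) split) (m+n∸n≡m (suc n) n)))
  count-ballot (suc b) (suc n) = begin
    count (suc b) (suc n) + (suc n + suc n + suc b) choose n
      ≡⟨ cong₂ _+_ (count-suc b n) (cong (_choose n) shape) ⟩
    p + q + suc m choose n               ≡⟨ cong (p + q +_) (sym (below-pascal m n)) ⟩
    p + q + (below m n + m choose n)     ≡⟨ solve 4 (λ p q x y → p :+ q :+ (x :+ y) := (q :+ x) :+ (p :+ y))
                                              refl p q (below m n) (m choose n) ⟩
    (q + below m n) + (p + m choose n)   ≡⟨ cong₂ _+_
      (subst (λ m → q + below m n ≡ m choose n) shape₂ (count-ballot (2 + b) n))
      (subst (λ m → p + m choose n ≡ m choose suc n) shape₁ (count-ballot b (suc n))) ⟩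
    m choose n + m choose suc n          ≡⟨ nCk+nC[k+1]≡[n+1]C[k+1] m n ⟩
    suc m choose suc n                   ≡⟨ cong (_choose suc n) (sym shape) ⟩
    (suc n + suc n + suc b) choose suc n ∎
    where
    open ≡-Reasoning
    open +-*-Solver
    m = 2 + (n + n + b)
    p = count b (suc n)
    q = count (2 + b) n
    shape : suc n + suc n + suc b ≡ suc m
    shape = solve 2 (λ n b → con 1 :+ n :+ (con 1 :+ n) :+ (con 1 :+ b) := con 3 :+ (n :+ n :+ b)) refl n b
    shape₁ : suc n + suc n + b ≡ m
    shape₁ = solve 2 (λ n b → con 1 :+ n :+ (con 1 :+ n) :+ b := con 2 :+ (n :+ n :+ b)) refl n b
    shape₂ : n + n + (2 + b) ≡ m
    shape₂ = solve 2 (λ n b → n :+ n :+ (con 2 :+ b) := con 2 :+ (n :+ n :+ b)) refl n b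

  choose-! : ∀ i j → (i + j) choose i * (i ! * j !) ≡ (i + j) !
  choose-! i j = subst (λ d → (i + j) choose i * (i ! * d !) ≡ (i + j) !) (m+n∸m≡n i j) eq
    where
    instance
      nz = i !* (i + j ∸ i) !≢0
    eq : (i + j) choose i * (i ! * (i + j ∸ i) !) ≡ (i + j) !
    eq = trans (cong (_* (i ! * (i + j ∸ i) !)) (nCk≡n!/k![n-k]! (m≤m+n i j)))
      (m/n*n≡m (k![n∸k]!∣n! (m≤m+n i j)))

  count-! : ∀ n → count 1 n * (suc n ! * suc (suc n) !) ≡ (2 * suc n) !
  count-! n = begin
    c * (suc n ! * suc (suc n) !)      ≡⟨ solve 4 (λ c n x y → c :* (x :* ((con 2 :+ n) :* y)) := (c :* (con 2 :+ n)) :* (x :* y))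
                                            refl c n (suc n !) (suc n !) ⟩
    c * (2 + n) * (suc n ! * suc n !)  ≡⟨ cong (_* (suc n ! * suc n !)) (+-cancelʳ-≡ (x * n) _ _ twice) ⟩
    (x + x) * (suc n ! * suc n !)      ≡⟨ solve 4 (λ x n y z → (x :+ x) :* (((con 1 :+ n) :* y) :* z) := (con 2 :+ (n :+ n)) :* (x :* (y :* z)))
                                            refl x n (n !) (suc n !) ⟩
    (2 + (n + n)) * (x * (n ! * suc n !)) ≡⟨ cong ((2 + (n + n)) *_) x-! ⟩
    (2 + (n + n)) * (1 + (n + n)) !    ≡⟨⟩
    (2 + (n + n)) !                    ≡⟨ cong _! (solve 1 (λ n → con 2 :+ (n :+ n) := con 2 :* (con 1 :+ n)) refl n) ⟩
    (2 * suc n) !                      ∎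
    where
    open ≡-Reasoning
    open +-*-Solver
    c = count 1 n
    m = 1 + (n + n)
    x = m choose n
    m-shape : n + n + 1 ≡ m
    m-shape = +-comm (n + n) 1
    x-! : x * (n ! * suc n !) ≡ m !
    x-! = subst (λ m → m choose n * (n ! * suc n !) ≡ m !) (+-suc n n) (choose-! n (suc n))
    ballot : c + below m n ≡ x
    ballot = subst (λ m → c + below m n ≡ m choose n) m-shape (count-ballot 1 n)
    below-ratio : ∀ n → let m = 1 + (n + n) in below m n * (2 + n) ≡ m choose n * n
    below-ratio zero    = refl
    below-ratio (suc n) = *-cancelʳ-≡ _ _ (n ! * suc (suc n) !) {{n !* suc (suc n) !≢0}} (begin
      m′ choose n * (3 + n) * (n ! * suc (suc n) !)
        ≡⟨ solve 4 (λ b n y z → b :* (con 3 :+ n) :* (y :* z) := b :* (y :* ((con 3 :+ n) :* z)))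
             refl (m′ choose n) n (n !) (suc (suc n) !) ⟩
      m′ choose n * (n ! * (3 + n) !)
        ≡⟨ subst (λ m → m choose n * (n ! * (3 + n) !) ≡ m !)
             (solve 1 (λ n → n :+ (con 3 :+ n) := con 1 :+ ((con 1 :+ n) :+ (con 1 :+ n))) refl n)
             (choose-! n (3 + n)) ⟩
      m′ !
        ≡⟨ sym (subst (λ m → m choose suc n * (suc n ! * (2 + n) !) ≡ m !)
             (+-suc (suc n) (suc n)) (choose-! (suc n) (2 + n))) ⟩
      m′ choose suc n * (suc n ! * suc (suc n) !)
        ≡⟨ solve 4 (λ b n y z → b :* (((con 1 :+ n) :* y) :* z) := b :* (con 1 :+ n) :* (y :* z))
             refl (m′ choose suc n) n (n !) (suc (suc n) !) ⟩
      m′ choose suc n * suc n * (n ! * suc (suc n) !) ∎)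
      where m′ = 1 + (suc n + suc n)
    twice : c * (2 + n) + x * n ≡ x + x + x * n
    twice = begin
      c * (2 + n) + x * n               ≡⟨ cong (c * (2 + n) +_) (sym (below-ratio n)) ⟩
      c * (2 + n) + below m n * (2 + n) ≡⟨ sym (*-distribʳ-+ (2 + n) c (below m n)) ⟩
      (c + below m n) * (2 + n)         ≡⟨ cong (_* (2 + n)) ballot ⟩
      x * (2 + n)                       ≡⟨ solve 2 (λ x n → x :* (con 2 :+ n) := x :+ x :+ x :* n) refl x n ⟩
      x + x + x * n                     ∎

  count-mono : ∀ n → count 1 n ≤ count 1 (suc n)
  count-mono n = ≤-trans (≤-reflexive (sym (count-zero n)))
    (≤-trans (m≤m+n _ (count 2 n)) (≤-reflexive (sym (count-suc 0 n))))

length-germs : ∀ k → length (germs k) ≡ catalan k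
length-germs zero    = refl
length-germs (suc n) = sym (trans (cong (_/ d) (sym (count-! n))) (m*n/n≡m (count 1 n) d))
  where
  d = suc n ! * suc (suc n) !
  instance nz = suc n !* suc (suc n) !≢0

catalan-mono : ∀ k → catalan k ≤ catalan (suc k)
catalan-mono k = subst₂ _≤_ (length-germs k) (length-germs (suc k)) (go k)
  where
  go : ∀ k → length (germs k) ≤ length (germs (suc k))
  go zero    = ≤-refl
  go (suc n) = count-mono n

germAt : ∀ k → Fin (catalan k) → Germ k
germAt k m = List.lookup (germs k) (cast (sym (length-germs k)) m)

indexOf : ∀ k → Germ k → Fin (catalan k)
indexOf k α = cast (length-germs k) (index (germs-complete k α))

Entry : Set
Entry = Maybe ℕ

pattern number p = just p
pattern ∗        = nothing

_≟ᴱ_ : DecidableEquality Entry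
_≟ᴱ_ = Maybeₚ.≡-dec _≟_

-- The position i of the rightmost nonzero entry of α together with
-- β(α), or nothing if α is null.
lower : ∀ {n} → Vec ℕ n → Maybe (ℕ × Vec ℕ n)
lower []                 = nothing
lower (_∷_ {n} a as) with lower as | a
... | just (i , bs) | _     = just (i , a ∷ bs)
... | nothing       | zero  = nothing
... | nothing       | suc b = just (suc n , b ∷ as)

-- X|Y ↦ Y|X.  The substring always begins with a number; the other
-- clauses are there for totality only.
swapXY : List Entry → List Entry
swapXY []              = []
swapXY (∗ ∷ es)        = ∗ ∷ es
swapXY (number Ω ∷ es) =
  let X , Y = break (_≟ᴱ number (suc Ω)) (number Ω ∷ es) in Y ++ X

-- W|X|Y|Z ↦ W|Y|X|Z with W and Z of length i.
castle : ℕ → List Entry → List Entry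
castle i f = take i f ++ swapXY (drop i (take r f)) ++ drop r f
  where r = length f ∸ i

F₀ : ℕ → List Entry
F₀ k = List.map number (upTo (suc k)) ++ List.replicate k ∗

-- The fuel is the number of times that β can be applied, see F-null and
-- F-step.
F-fuel : ∀ k → ℕ → Vec ℕ (k ∸ 1) → List Entry
F-fuel k zero    α = F₀ k
F-fuel k (suc s) α with lower α
... | nothing      = F₀ k
... | just (i , β) = castle i (F-fuel k s β)

F : ∀ k → Germ k → List Entry
F k (α , _) = F-fuel k (Vec.sum α) α

lower-null : ∀ n → lower (Vec.replicate n 0) ≡ nothing
lower-null zero = refl
lower-null (suc n) rewrite lower-null n = refl

lower-sum : ∀ {n} (α : Vec ℕ n) {i β} → lower α ≡ just (i , β) → Vec.sum α ≡ suc (Vec.sum β)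
lower-sum (a ∷ as) eq with lower as in eqs | a
lower-sum (a ∷ as) refl | just _  | a′    = trans (cong (a′ +_) (lower-sum as eqs)) (+-suc a′ _)
lower-sum (a ∷ as) refl | nothing | suc _ = refl

F-null : ∀ k s → F-fuel k s (Vec.replicate (k ∸ 1) 0) ≡ F₀ k
F-null k zero = refl
F-null k (suc s) rewrite lower-null (k ∸ 1) = refl

F-step : ∀ k α {i β} → lower α ≡ just (i , β) →
         F-fuel k (Vec.sum α) α ≡ castle i (F-fuel k (Vec.sum β) β)
F-step k α eq rewrite lower-sum α eq | eq = refl

bit : Entry → Bool
bit (number _) = false
bit ∗          = true

θ : ∀ k → Germ k → List Bool
θ k α = List.map bit (F k α)

setBitAt : ℕ → Entry → Bool
setBitAt p e = bit e ∨ does (e ≟ᴱ number p)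

θ-flipped : ∀ k → ℕ → Germ k → List Bool
θ-flipped k p α = List.map (setBitAt p) (F k α)

complementedReversal : List Bool → List Bool
complementedReversal u = List.map not (reverse u)

CyclicTranslate : List Bool → List Bool → Set
CyclicTranslate u v = ∃ λ (s : Fin (length v)) → u ≡ drop (toℕ s) v ++ take (toℕ s) v

cyclicTranslate? : ∀ u v → Dec (CyclicTranslate u v)
cyclicTranslate? u v = any? λ s → Listₚ.≡-dec Boolₚ._≟_ u (drop (toℕ s) v ++ take (toℕ s) v)

-- α^p.  For k > 0 and p ≤ k exactly one germ passes the test, so neither
-- the order of the search nor its default value matters.
neighbour : ∀ k → ℕ → Germ k → Germ k
neighbour k p α = fromMaybe (nullGerm k)
  (find (λ γ → cyclicTranslate? (complementedReversal (θ-flipped k p α)) (θ k γ)) (germs k))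

-- The column α^p of CAT(k) as an integer sequence.
CAT : ∀ k → ℕ → Fin (catalan k) → ℕ
CAT k p m = toℕ (indexOf k (neighbour k p (germAt k m)))

-- j(α^p)
j : ℕ → ℕ → ℕ
j k p with p ≟ k
... | yes _ = k ∸ 1
... | no  _ = suc p

Involutive : ∀ {N} → Permutation′ N → Set
Involutive π = (π ∘ₚ π) ≈ id

InvolutivePermutation : ∀ N → (Fin N → ℕ) → Set
InvolutivePermutation N s =
  Σ[ π ∈ Permutation′ N ] (∀ m → toℕ (π ⟨$⟩ʳ m) ≡ s m) × Involutive π

-- The k-th part of 𝒮₁ has m ∈ [partStart k , catalan k).  The first part
-- is [0 , 2), although catalan 1 ≡ 1.
partStart : ℕ → ℕ
partStart 2 = 0
partStart k = catalan (k ∸ 1)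

module Submission where

-- F(α) is the Dyck word of an ordered forest whose k nodes are labelled in
-- breadth-first order, each level from right to left.  Castling adds the nodes
-- in decreasing order of their labels: the entry a at position i keeps the a
-- rightmost trees and makes the others the children of a new node i at the
-- right.  Reading this backwards, a_{p+1} + 1 is the length of the queue of the
-- breadth-first traversal after p nodes.
--
-- Changing the entry p to an asterisk and taking the complemented reversal
-- exchanges, along the path to the node p, the siblings on the left at one level
-- with the mirrored siblings on the right one level deeper.  This
-- is an involution; it keeps the label p of the node and mirrors the queue
-- after p nodes, hence preserves a_{p+1}.  Prefixing a zero attaches a leaf
-- k + 1 to the leaf k, which commutes with the exchange for p = k - 1, and
-- takes the exchange for p = k to that for p = k + 1.  For p = k - 1 a germ
-- with a_{k-1} = 0 goes to one with a_{k-1} = 1, so an involution is determined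
-- by the rows with a_{k-1} = 1.

open import Defs
open import Data.Bool.Base using (Bool; true; false; not)
open import Data.Empty using (⊥)
open import Data.Fin.Base as Fin using (Fin; toℕ; inject≤; fromℕ<; cast)
open import Data.Fin.Permutation using (Permutation′; _⟨$⟩ʳ_; permutation)
import Data.Fin.Properties as Fin
open import Data.List.Base
  using (List; []; _∷_; [_]; _++_; map; length; take; drop; reverse; break; upTo; replicate; lookup; find)
open import Data.List.Membership.Propositional using (_∈_)
open import Data.List.Membership.Propositional.Properties using (∈-lookup)
open import Data.List.Properties
open import Data.List.Relation.Unary.All as All using (All; []; _∷_)
import Data.List.Relation.Unary.All.Properties as All
open import Data.List.Relation.Unary.AllPairs using (AllPairs; []; _∷_)
open import Data.List.Relation.Unary.Any using (here; there)
open import Data.List.Relation.Unary.Any.Properties using (lookup-index)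
open import Data.Maybe.Base using (just; nothing; fromMaybe)
import Data.Maybe.Properties as Maybe
open import Data.Nat.Base using (ℕ; zero; suc; _+_; _∸_; _≤_; _<_; z≤n; s≤s)
open import Data.Nat.Properties
open import Data.Nat.Solver using (module +-*-Solver)
open import Data.Product.Base using (_×_; _,_; Σ-syntax; ∃-syntax)
open import Data.Sum.Base using (_⊎_; inj₁; inj₂)
open import Data.Unit.Base using (⊤; tt)
open import Data.Vec.Base as Vec using (Vec; []; _∷_)
import Data.Vec.Relation.Binary.Lex.Strict as Lex
import Data.Vec.Relation.Binary.Pointwise.Inductive as Pointwise
open import Function.Base using (_∘_; const)
open import Relation.Binary.PropositionalEquality hiding ([_])
open import Relation.Nullary.Decidable using (Dec; yes; no; dec-true; dec-false)
open import Relation.Nullary.Negation using (¬_; contradiction)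

-- A colour change reverses and complements the bits around the node p. The flipped bit of p becomes
-- 0 again, so p stays a node; the asterisks closing the path to p become opening entries. The one
-- closing the root of the path serves as the leading 0 of the new `F`, which fixes the rotation,
-- and every other one opens the node one step further up. This is why left siblings trade places
-- with right siblings one level deeper, and why the trees to the right of the root of the path stay
-- there and are only mirrored. `neighbour` searches for a germ whose `θ` is a translate; by the
-- cycle lemma it is enough to exhibit one. The obstacle is the labels. A germ sees only the shape
-- of its forest, while the forest after the exchange carries the old labels, in general no longer
-- in breadth-first order. Forests are therefore compared by `_≅_`, up to labels, and the place of p
-- is controlled by counting: the nodes popped up to p and those of the trees in the queue exhaust
-- the forest, and mirroring does not change the size of the queue.

-- Forests are listed from right to left: the head is the rightmost tree.
data Tree : Set where
  node : ℕ → List Tree → Tree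

Forest : Set
Forest = List Tree

-- Growing a forest and its breadth-first traversal

grow : ℕ → ℕ → Forest → Forest
grow x a f = node x (drop a f) ∷ take a f

forestFrom : ∀ {n} → Forest → Vec ℕ n → Forest
forestFrom         f []       = f
forestFrom {suc n} f (a ∷ as) = forestFrom (grow (suc n) a f) as

forest : ∀ k → Germ k → Forest
forest k α = forestFrom [ node k [] ] (string α)

-- pop undoes grow.  Its iterates run through the nodes breadth first, each
-- level from right to left, with the forest as queue.
pop : Forest → Forest
pop []               = []
pop (node _ cs ∷ ts) = ts ++ cs

pops : ℕ → Forest → Forest
pops zero    f = f
pops (suc n) f = pops n (pop f)

pops-+ : ∀ m n f → pops (m + n) f ≡ pops n (pops m f)
pops-+ zero    n f = refl
pops-+ (suc m) n f = pops-+ m n (pop f)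

pops-suc : ∀ n f → pops (suc n) f ≡ pop (pops n f)
pops-suc n f = trans (cong (λ m → pops m f) (sym (+-comm n 1))) (pops-+ n 1 f)

pops-[] : ∀ n → pops n [] ≡ []
pops-[] zero    = refl
pops-[] (suc n) = pops-[] n

pop-grow : ∀ x a f → pop (grow x a f) ≡ f
pop-grow x a f = take++drop≡id a f

length-grow : ∀ x {a} f → a ≤ length f → length (grow x a f) ≡ suc a
length-grow x {a} f a≤ = cong suc (trans (length-take a f) (m≤n⇒m⊓n≡m a≤))

pops-forestFrom : ∀ {n} f (as : Vec ℕ n) → pops n (forestFrom f as) ≡ f
pops-forestFrom         f []       = refl
pops-forestFrom {suc n} f (a ∷ as) = trans (pops-suc n _)
  (trans (cong pop (pops-forestFrom (grow (suc n) a f) as)) (pop-grow (suc n) a f))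

-- The first `p` pops undo the `grow` steps at positions 1 to `p`; the step before them, at position
-- `p + 1`, leaves as many old trees as its entry says, and the new node.
length-pops : ∀ {n} f (as : Vec ℕ n) → Restricted (length f) as →
  ∀ p → p < n → length (pops p (forestFrom f as)) ≡ suc (entry as (suc p))
length-pops {suc n} f (a ∷ as) (a≤ ∷ r) p p<n with suc p ≟ suc n
... | yes refl = trans (cong length (pops-forestFrom (grow (suc n) a f) as)) (length-grow (suc n) f a≤)
... | no  p≢n  = length-pops (grow (suc n) a f) as
  (subst (λ b → Restricted b as) (sym (length-grow (suc n) f a≤)) r)
  p (≤∧≢⇒< (≤-pred p<n) (p≢n ∘ cong suc))

-- The node added last has the least label and stands at the head, so nodes are popped in the
-- opposite order to the one in which they were added.
pops-label : ∀ {n} f (as : Vec ℕ n) →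
  (∀ m {x cs ts} → pops m f ≡ node x cs ∷ ts → x ≡ suc (n + m)) →
  ∀ m {x cs ts} → pops m (forestFrom f as) ≡ node x cs ∷ ts → x ≡ suc m
pops-label         f []       h = h
pops-label {suc n} f (a ∷ as) h = pops-label (grow (suc n) a f) as λ where
  zero    refl → cong suc (sym (+-identityʳ n))
  (suc m) eq   → trans (h m (trans (cong (pops m) (sym (pop-grow (suc n) a f))) eq)) (cong suc (sym (+-suc n m)))

forest-label : ∀ n (α : Germ (suc n)) m {x cs ts} → pops m (forest (suc n) α) ≡ node x cs ∷ ts → x ≡ suc m
forest-label n α = pops-label [ node (suc n) [] ] (string α) λ where
  zero    refl → cong suc (sym (+-identityʳ n))
  (suc m) eq   → contradiction (trans (sym (pops-[] m)) eq) λ ()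

-- Additive weights: sizes and label counts

weight : (ℕ → ℕ) → Forest → ℕ
weight w []               = 0
weight w (node x cs ∷ ts) = w x + weight w cs + weight w ts

size : Forest → ℕ
size = weight (const 1)

δ : ℕ → ℕ → ℕ
δ p x with x ≟ p
... | yes _ = 1
... | no  _ = 0

occurrences : ℕ → Forest → ℕ
occurrences p = weight (δ p)

Distinct : Forest → Set
Distinct f = ∀ p → occurrences p f ≤ 1

δ-refl : ∀ p → δ p p ≡ 1
δ-refl p with p ≟ p
... | yes _   = refl
... | no  p≢p = contradiction refl p≢p

δ-≢ : ∀ {p x} → x ≢ p → δ p x ≡ 0
δ-≢ {p} {x} x≢p with x ≟ p
... | yes x≡p = contradiction x≡p x≢p
... | no  _   = refl

δ≡0 : ∀ {p x} → δ p x ≡ 0 → x ≢ p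
δ≡0 {p} d refl with () ← trans (sym (δ-refl p)) d

δ≤1 : ∀ p x → δ p x ≤ 1
δ≤1 p x with x ≟ p
... | yes _ = ≤-refl
... | no  _ = z≤n

weight-++ : ∀ w f g → weight w (f ++ g) ≡ weight w f + weight w g
weight-++ w []               g = refl
weight-++ w (node x cs ∷ ts) g =
  trans (cong (w x + weight w cs +_) (weight-++ w ts g)) (sym (+-assoc (w x + weight w cs) _ _))

weight-pop : ∀ w x cs ts → w x + weight w (ts ++ cs) ≡ weight w (node x cs ∷ ts)
weight-pop w x cs ts = trans (cong (w x +_) (trans (weight-++ w ts cs) (+-comm (weight w ts) _)))
  (sym (+-assoc (w x) _ _))

weight-grow : ∀ w x a f → weight w (grow x a f) ≡ w x + weight w f
weight-grow w x a f = trans (sym (weight-pop w x (drop a f) (take a f)))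
  (cong (λ g → w x + weight w g) (take++drop≡id a f))

-- `pop` is idle on the empty forest, so pops count nodes only while a tree is left.
size-pops : ∀ n f {t ts} → pops n f ≡ t ∷ ts → n + size (t ∷ ts) ≡ size f
size-pops zero    f                refl = refl
size-pops (suc n) []               eq   = contradiction (trans (sym (pops-[] n)) eq) λ ()
size-pops (suc n) (node x cs ∷ ts) eq   = trans (cong suc (size-pops n (ts ++ cs) eq)) (weight-pop (const 1) x cs ts)

weight-pop-≤ : ∀ w f → weight w (pop f) ≤ weight w f
weight-pop-≤ w []               = z≤n
weight-pop-≤ w (node x cs ∷ ts) = ≤-trans (m≤n+m _ (w x)) (≤-reflexive (weight-pop w x cs ts))

weight-pops-≤ : ∀ w n f → weight w (pops n f) ≤ weight w f
weight-pops-≤ w zero    f = ≤-refl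
weight-pops-≤ w (suc n) f = ≤-trans (weight-pops-≤ w n (pop f)) (weight-pop-≤ w f)

size-forestFrom : ∀ {n} f (as : Vec ℕ n) → size (forestFrom f as) ≡ n + size f
size-forestFrom         f []       = refl
size-forestFrom {suc n} f (a ∷ as) = trans (size-forestFrom _ as)
  (trans (cong (n +_) (weight-grow (const 1) (suc n) a f)) (+-suc n _))

size-forest : ∀ n (α : Germ (suc n)) → size (forest (suc n) α) ≡ suc n
size-forest n α = trans (size-forestFrom _ (string α)) (+-comm n 1)

-- The labels up to `n` are still free for the coming `grow` steps. At `n = 0` this keeps the label
-- 0 for the leading entry of `F`.
record Labelled (n : ℕ) (f : Forest) : Set where
  field
    distinct : Distinct f
    fresh    : ∀ {p} → p ≤ n → occurrences p f ≡ 0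

open Labelled

grow-labelled : ∀ {n f} a → Labelled (suc n) f → Labelled n (grow (suc n) a f)
grow-labelled {n} {f} a l .distinct p with ≤-<-connex p (suc n)
... | inj₁ p≤ = ≤-trans (≤-reflexive (trans (weight-grow _ (suc n) a f) (cong (δ p (suc n) +_) (l .fresh p≤))))
                  (≤-trans (≤-reflexive (+-identityʳ _)) (δ≤1 p (suc n)))
... | inj₂ n<p = ≤-trans (≤-reflexive (trans (weight-grow _ (suc n) a f) (cong (_+ occurrences p f) (δ-≢ (<⇒≢ n<p))))) (l .distinct p)
grow-labelled {n} {f} a l .fresh {p} p≤n = trans (weight-grow _ (suc n) a f)
  (cong₂ _+_ (δ-≢ (λ sn≡p → <-irrefl (sym sn≡p) (s≤s p≤n) )) (l .fresh (m≤n⇒m≤1+n p≤n)))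

forestFrom-labelled : ∀ {n f} (as : Vec ℕ n) → Labelled n f → Labelled 0 (forestFrom f as)
forestFrom-labelled []       l = l
forestFrom-labelled (a ∷ as) l = forestFrom-labelled as (grow-labelled a l)

leaf-labelled : ∀ n → Labelled n [ node (suc n) [] ]
leaf-labelled n .distinct p  = subst (_≤ 1) (sym (trans (+-identityʳ _) (+-identityʳ _))) (δ≤1 p (suc n))
leaf-labelled n .fresh p≤n   = trans (+-identityʳ _) (trans (+-identityʳ _) (δ-≢ λ sn≡p → <-irrefl (sym sn≡p) (s≤s p≤n)))

forest-labelled : ∀ n (α : Germ (suc n)) → Labelled 0 (forest (suc n) α)
forest-labelled n α = forestFrom-labelled (string α) (leaf-labelled n)

occurs-forestFrom : ∀ {n} f (as : Vec ℕ n) p → 1 ≤ p → p ≤ n ⊎ 1 ≤ occurrences p f → 1 ≤ occurrences p (forestFrom f as)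
occurs-forestFrom f [] (suc p) _ (inj₂ 1≤) = 1≤
occurs-forestFrom {suc n} f (a ∷ as) p 1≤p h = occurs-forestFrom (grow (suc n) a f) as p 1≤p (step h)
  where
  eq = weight-grow (δ p) (suc n) a f
  step : p ≤ suc n ⊎ 1 ≤ occurrences p f → p ≤ n ⊎ 1 ≤ occurrences p (grow (suc n) a f)
  step (inj₁ p≤) with m≤n⇒m<n∨m≡n p≤
  ... | inj₁ p<   = inj₁ (≤-pred p<)
  ... | inj₂ refl = inj₂ (≤-trans (≤-trans (≤-reflexive (sym (δ-refl p))) (m≤m+n _ _)) (≤-reflexive (sym eq)))
  step (inj₂ 1≤) = inj₂ (≤-trans 1≤ (≤-trans (m≤n+m _ _) (≤-reflexive (sym eq))))

occurs-forest : ∀ n (α : Germ (suc n)) p → 1 ≤ p → p ≤ suc n → 1 ≤ occurrences p (forest (suc n) α)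
occurs-forest n α p 1≤p p≤ = occurs-forestFrom _ (string α) p 1≤p (h (m≤n⇒m<n∨m≡n p≤))
  where
  h : p < suc n ⊎ p ≡ suc n → p ≤ n ⊎ 1 ≤ occurrences p [ node (suc n) [] ]
  h (inj₁ p<)   = inj₁ (≤-pred p<)
  h (inj₂ refl) = inj₂ (≤-reflexive (sym (trans (+-identityʳ _) (trans (+-identityʳ _) (δ-refl p)))))

-- Castling

enc : Forest → List Entry
enc []               = []
enc (node x cs ∷ ts) = enc ts ++ number x ∷ enc cs ++ [ ∗ ]

enc-++ : ∀ f g → enc (f ++ g) ≡ enc g ++ enc f
enc-++ []               g = sym (++-identityʳ (enc g))
enc-++ (node x cs ∷ ts) g = trans (cong (_++ number x ∷ enc cs ++ [ ∗ ]) (enc-++ ts g)) (++-assoc (enc g) (enc ts) _)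

enc-absent : ∀ q f → occurrences q f ≡ 0 → All (_≢ number q) (enc f)
enc-absent q []               _  = []
enc-absent q (node x cs ∷ ts) o0 = All.++⁺ (enc-absent q ts (m+n≡0⇒n≡0 (δ q x + occurrences q cs) o0))
  ((λ { refl → δ≡0 {q} {x} (m+n≡0⇒m≡0 _ d+cs) refl }) ∷
   All.++⁺ (enc-absent q cs (m+n≡0⇒n≡0 (δ q x) d+cs)) ((λ ()) ∷ []))
  where d+cs = m+n≡0⇒m≡0 (δ q x + occurrences q cs) o0

break-first : ∀ q xs ys → All (_≢ number q) xs →
  break (_≟ᴱ number q) (xs ++ number q ∷ ys) ≡ (xs , number q ∷ ys)
break-first q []       ys []         rewrite dec-true (number q ≟ᴱ number q) refl = refl
break-first q (x ∷ xs) ys (x≢ ∷ xs≢) rewrite dec-false (x ≟ᴱ number q) x≢ | break-first q xs ys xs≢ = refl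

swapXY-first : ∀ Ω xs ys → All (_≢ number (suc Ω)) xs →
  swapXY (number Ω ∷ xs ++ number (suc Ω) ∷ ys) ≡ (number (suc Ω) ∷ ys) ++ number Ω ∷ xs
swapXY-first Ω xs ys xs≢ rewrite break-first (suc Ω) (number Ω ∷ xs) ys ((λ ()) ∷ xs≢) = refl

Rooted : ℕ → Forest → Set
Rooted i []              = ⊤
Rooted i (node x _ ∷ ts) = x ≡ i × Rooted (suc i) ts

rooted-take : ∀ i a f → Rooted i f → Rooted i (take a f)
rooted-take i zero    f               r        = tt
rooted-take i (suc a) []              r        = tt
rooted-take i (suc a) (node x _ ∷ ts) (eq , r) = eq , rooted-take (suc i) a ts r

rooted-split : ∀ i b f → Rooted i f → b < length f →
  ∃[ xs ] ∃[ cs ] ∃[ ys ] f ≡ xs ++ node (i + b) cs ∷ ys × length xs ≡ b × Rooted (suc (i + b)) ys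
rooted-split i zero    (node x cs ∷ ts) (refl , r) _ rewrite +-identityʳ i = [] , cs , ts , refl , refl , r
rooted-split i (suc b) (t@(node _ _) ∷ ts) (_ , r) (s≤s b<) with rooted-split (suc i) b ts r b<
... | xs , cs , ys , refl , refl , r′ rewrite +-suc i (length xs) = t ∷ xs , cs , ys , refl , refl , r′

take-length-+ : ∀ {A : Set} (xs : List A) n ys → take (length xs + n) (xs ++ ys) ≡ xs ++ take n ys
take-length-+ []       n ys = refl
take-length-+ (x ∷ xs) n ys = cong (x ∷_) (take-length-+ xs n ys)

drop-length-+ : ∀ {A : Set} (xs : List A) n ys → drop (length xs + n) (xs ++ ys) ≡ drop n ys
drop-length-+ []       n ys = refl
drop-length-+ (x ∷ xs) n ys = drop-length-+ xs n ys

+≤1⇒≡0 : ∀ m {n} → m + n ≤ 1 → 1 ≤ n → m ≡ 0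
+≤1⇒≡0 zero    _        _   = refl
+≤1⇒≡0 (suc m) (s≤s le) 1≤n = contradiction (≤-trans 1≤n (≤-trans (m≤n+m _ m) le)) λ ()

occurrences-root : ∀ p cs ts → 1 ≤ occurrences p (node p cs ∷ ts)
occurrences-root p cs ts = ≤-trans (≤-reflexive (sym (δ-refl p))) (≤-trans (m≤m+n _ (occurrences p cs)) (m≤m+n _ _))

-- If f is the forest of the entries at positions above i, then middle i b f
-- is F(α) without its first and last i entries, where α continues with the
-- entry b at position i and zeros after it.
middle : ℕ → ℕ → Forest → List Entry
middle i b f = enc (take b f) ++ number i ∷ enc (drop b f)

-- Here `Ω` is `i + b`: the root of the leftmost kept tree, or `i` itself if none is kept. The tree
-- with root `Ω + 1` is the rightmost child of `i` and is therefore written last, so `Y` is exactly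
-- this tree, and the swap moves it from the children to the kept trees. Distinct labels make its
-- root the first occurrence of `Ω + 1`.
swapXY-middle : ∀ i b f → Rooted (suc i) f → Distinct f → b < length f →
  swapXY (middle i b f) ≡ middle i (suc b) f
swapXY-middle i zero (node _ cs ∷ ts) (refl , _) dist _ =
  swapXY-first i (enc ts) _ (enc-absent (suc i) ts (+≤1⇒≡0 _
    (≤-trans (≤-reflexive (+-comm (occurrences (suc i) ts) _)) (dist (suc i)))
    (≤-trans (≤-reflexive (sym (δ-refl (suc i)))) (m≤m+n _ (occurrences (suc i) cs)))))
swapXY-middle i (suc b) f r dist b< with rooted-split (suc i) b f r (<⇒≤ b<)
... | xs , cs , [] , refl , refl , _ =
  contradiction (≤-trans b< (≤-reflexive (trans (length-++ xs) (+-comm _ 1)))) (<-irrefl refl)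
... | xs , cs , node _ ds ∷ ys , refl , refl , refl , _ = begin
  swapXY (middle i (suc b) f)
    ≡⟨ cong swapXY (cong₂ (λ u v → enc u ++ number i ∷ enc v) (takes 1) (drops 1)) ⟩
  swapXY (enc (xs ++ t ∷ []) ++ number i ∷ enc (t′ ∷ ys))
    ≡⟨ cong swapXY (trans (cong (_++ number i ∷ enc (t′ ∷ ys)) (enc-++ xs (t ∷ [])))
         (trans (++-assoc (enc (t ∷ [])) (enc xs) _)
           (cong (number Ω ∷_) (sym (trans (++-assoc es (enc xs ++ number i ∷ enc ys) _)
             (cong (es ++_) (++-assoc (enc xs) (number i ∷ enc ys) _))))))) ⟩
  swapXY (number Ω ∷ (es ++ enc xs ++ number i ∷ enc ys) ++ number (suc Ω) ∷ enc ds ++ [ ∗ ])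
    ≡⟨ swapXY-first Ω _ _ absent ⟩
  (number (suc Ω) ∷ enc ds ++ [ ∗ ]) ++ (number Ω ∷ es) ++ enc xs ++ number i ∷ enc ys
    ≡⟨ sym (trans (cong (_++ number i ∷ enc ys) (enc-++ xs (t ∷ t′ ∷ [])))
         (trans (++-assoc (enc (t ∷ t′ ∷ [])) (enc xs) _) (++-assoc (enc (t′ ∷ [])) (enc (t ∷ [])) _))) ⟩
  enc (xs ++ t ∷ t′ ∷ []) ++ number i ∷ enc ys
    ≡⟨ sym (cong₂ (λ u v → enc u ++ number i ∷ enc v) (takes 2) (drops 2)) ⟩
  middle i (suc (suc b)) f ∎
  where
  open ≡-Reasoning
  Ω = suc i + length xs
  t = node Ω cs
  t′ = node (suc Ω) ds
  es = enc cs ++ [ ∗ ]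
  takes : ∀ m → take (m + length xs) f ≡ xs ++ take m (t ∷ t′ ∷ ys)
  takes m = trans (cong (λ l → take l f) (+-comm m (length xs))) (take-length-+ xs m _)
  drops : ∀ m → drop (m + length xs) f ≡ drop m (t ∷ t′ ∷ ys)
  drops m = trans (cong (λ l → drop l f) (+-comm m (length xs))) (drop-length-+ xs m _)
  occ = occurrences (suc Ω)
  total : occ xs + (δ (suc Ω) Ω + occ cs + occ (t′ ∷ ys)) ≤ 1
  total = ≤-trans (≤-reflexive (sym (weight-++ _ xs (t ∷ t′ ∷ ys)))) (dist (suc Ω))
  root = occurrences-root (suc Ω) ds ys
  xs0 = +≤1⇒≡0 (occ xs) total (≤-trans root (m≤n+m _ (δ (suc Ω) Ω + occ cs)))
  rest = ≤-trans (m≤n+m _ (occ xs)) total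
  cs0 = m+n≡0⇒n≡0 (δ (suc Ω) Ω) (+≤1⇒≡0 (δ (suc Ω) Ω + occ cs) rest root)
  ys0 = +≤1⇒≡0 (occ ys) (≤-trans (≤-reflexive (+-comm (occ ys) _)) (≤-trans (m≤n+m _ (δ (suc Ω) Ω + occ cs)) rest))
          (≤-trans (≤-reflexive (sym (δ-refl (suc Ω)))) (m≤m+n _ (occ ds)))
  absent : All (_≢ number (suc Ω)) (es ++ enc xs ++ number i ∷ enc ys)
  absent = All.++⁺ (All.++⁺ (enc-absent (suc Ω) cs cs0) ((λ ()) ∷ []))
    (All.++⁺ (enc-absent (suc Ω) xs xs0) (<⇒≢ (m≤n⇒m≤1+n (s≤s (m≤m+n i (length xs)))) ∘ Maybe.just-injective ∷ enc-absent (suc Ω) ys ys0))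

take-length : ∀ {A : Set} (xs ys : List A) → take (length xs) (xs ++ ys) ≡ xs
take-length []       ys = refl
take-length (x ∷ xs) ys = cong (x ∷_) (take-length xs ys)

drop-length : ∀ {A : Set} (xs ys : List A) → drop (length xs) (xs ++ ys) ≡ ys
drop-length []       ys = refl
drop-length (x ∷ xs) ys = drop-length xs ys

castle-middle : ∀ ws ms zs → length ws ≡ length zs →
  castle (length ws) (ws ++ ms ++ zs) ≡ ws ++ swapXY ms ++ zs
castle-middle ws ms zs eq = trans
  (cong (λ r → take (length ws) all ++ swapXY (drop (length ws) (take r all)) ++ drop r all) len)
  (cong₂ _++_ (take-length ws _) (cong₂ (λ u v → swapXY u ++ v)
    (trans (cong (drop (length ws)) (take-length-+ ws (length ms) (ms ++ zs)))
      (trans (drop-length ws _) (take-length ms zs)))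
    (trans (drop-length-+ ws (length ms) (ms ++ zs)) (drop-length ms zs))))
  where
  all = ws ++ ms ++ zs
  len : length (ws ++ ms ++ zs) ∸ length ws ≡ length ws + length ms
  len = trans (cong (_∸ length ws) (trans (length-++ ws) (trans (cong (length ws +_) (length-++ ms))
    (trans (sym (+-assoc (length ws) _ _)) (cong (length ws + length ms +_) (sym eq)))))) (m+n∸n≡m _ (length ws))

lower-zeros : ∀ {n} (as : Vec ℕ (suc n)) → lower as ≡ nothing → ∃[ bs ] as ≡ 0 ∷ bs × lower bs ≡ nothing
lower-zeros (a ∷ bs) eq with lower bs in eqs | a
... | nothing | zero = bs , refl , eqs

-- Each zero wraps the whole forest in one node, adding a label in front and an asterisk behind. The
-- asterisk closing `x` is counted in the final run, which makes this run as long as the initial run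
-- of labels: they are `Z` and `W`.
enc-zeroTail : ∀ {n} (as : Vec ℕ n) → lower as ≡ nothing → ∀ x cs ts →
  number 0 ∷ enc (forestFrom (node x cs ∷ ts) as) ≡
  map number (upTo (suc n)) ++ (enc ts ++ number x ∷ enc cs) ++ replicate (suc n) ∗
enc-zeroTail [] _ x cs ts = cong (number 0 ∷_) (sym (++-assoc (enc ts) _ [ ∗ ]))
enc-zeroTail {suc n} as eq x cs ts with lower-zeros as eq
... | bs , refl , eqs = begin
  number 0 ∷ enc (forestFrom [ node (suc n) (node x cs ∷ ts) ] bs)
    ≡⟨ enc-zeroTail bs eqs (suc n) (node x cs ∷ ts) [] ⟩
  ws ++ number (suc n) ∷ enc (node x cs ∷ ts) ++ zs
    ≡⟨ sym (++-assoc ws [ number (suc n) ] _) ⟩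
  (ws ++ [ number (suc n) ]) ++ enc (node x cs ∷ ts) ++ zs
    ≡⟨ cong₂ _++_ (trans (sym (map-++ number (upTo (suc n)) [ suc n ])) (cong (map number) (upTo-∷ʳ (suc n))))
         (trans (cong (_++ zs) (sym (++-assoc (enc ts) _ [ ∗ ]))) (++-assoc _ [ ∗ ] zs)) ⟩
  map number (upTo (suc (suc n))) ++ (enc ts ++ number x ∷ enc cs) ++ ∗ ∷ zs ∎
  where
  open ≡-Reasoning
  ws = map number (upTo (suc n))
  zs = replicate (suc n) ∗

-- The entries before the lowered one grow the same forest and those after it are zeros, so by
-- `enc-zeroTail` only the middle parts differ.
castle-lower : ∀ {n} (α : Vec ℕ n) f {i β} → Rooted (suc n) f → Labelled n f → Restricted (length f) α →
  lower α ≡ just (i , β) → castle i (number 0 ∷ enc (forestFrom f β)) ≡ number 0 ∷ enc (forestFrom f α)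
castle-lower {suc n} (a ∷ as) f r l (a≤ ∷ rs) eq with lower as in eqs | a
castle-lower {suc n} (_ ∷ as) f r l (a≤ ∷ rs) refl | just _  | a = castle-lower as (grow (suc n) a f)
  (refl , rooted-take _ a f r) (grow-labelled a l)
  (subst (λ b → Restricted b as) (sym (length-grow (suc n) f a≤)) rs) eqs
castle-lower {suc n} (_ ∷ as) f r l (a≤ ∷ rs) refl | nothing | suc b = begin
  castle (suc n) (number 0 ∷ enc (forestFrom (grow (suc n) b f) as))
    ≡⟨ cong (castle (suc n)) (enc-zeroTail as eqs (suc n) (drop b f) (take b f)) ⟩
  castle (suc n) (ws ++ middle (suc n) b f ++ zs)
    ≡⟨ cong (λ l → castle l (ws ++ middle (suc n) b f ++ zs)) (sym lws) ⟩
  castle (length ws) (ws ++ middle (suc n) b f ++ zs)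
    ≡⟨ castle-middle ws _ zs (trans lws (sym (length-replicate (suc n)))) ⟩
  ws ++ swapXY (middle (suc n) b f) ++ zs
    ≡⟨ cong (λ m → ws ++ m ++ zs) (swapXY-middle (suc n) b f r (l .distinct) a≤) ⟩
  ws ++ middle (suc n) (suc b) f ++ zs
    ≡⟨ sym (enc-zeroTail as eqs (suc n) (drop (suc b) f) (take (suc b) f)) ⟩
  number 0 ∷ enc (forestFrom (grow (suc n) (suc b) f) as) ∎
  where
  open ≡-Reasoning
  ws = map number (upTo (suc n))
  zs = replicate (suc n) ∗
  lws : length ws ≡ suc n
  lws = trans (length-map number (upTo (suc n))) (length-upTo (suc n))

zeros-restricted : ∀ {n} b c (as : Vec ℕ n) → lower as ≡ nothing → Restricted b as → Restricted c as
zeros-restricted b c [] _ [] = []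
zeros-restricted b c (a ∷ as) eq (_ ∷ r) with lower as in eqs | a
... | nothing | zero = z≤n ∷ r

lower-restricted : ∀ {n b} (α : Vec ℕ n) {i β} → Restricted b α → lower α ≡ just (i , β) → Restricted b β
lower-restricted (a ∷ as) (a≤ ∷ r) eq with lower as in eqs | a
lower-restricted (_ ∷ as) (a≤ ∷ r) refl | just _  | a     = a≤ ∷ lower-restricted as r eqs
lower-restricted (_ ∷ as) (a≤ ∷ r) refl | nothing | suc b = <⇒≤ a≤ ∷ zeros-restricted _ _ as eqs r

F-fuel-forest : ∀ n s (α : Vec ℕ n) → Restricted 1 α → Vec.sum α ≡ s →
  F-fuel (suc n) s α ≡ number 0 ∷ enc (forestFrom [ node (suc n) [] ] α)
F-fuel-forest n s α r Σ≡s with lower α in eq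
F-fuel-forest n zero α r Σ≡s | just _ = contradiction (trans (sym Σ≡s) (lower-sum α eq)) λ ()
F-fuel-forest n (suc s) α r Σ≡s | just (i , β) rewrite eq = trans
  (cong (castle i) (F-fuel-forest n s β (lower-restricted α r eq) (suc-injective (trans (sym (lower-sum α eq)) Σ≡s))))
  (castle-lower α [ node (suc n) [] ] (refl , tt) (leaf-labelled n) r eq)
F-fuel-forest n s α r Σ≡s | nothing = trans (null s) (sym (trans (enc-zeroTail α eq (suc n) [] [])
    (trans (sym (++-assoc (map number (upTo (suc n))) [ number (suc n) ] _))
      (cong (_++ replicate (suc n) ∗)
        (trans (sym (map-++ number (upTo (suc n)) [ suc n ])) (cong (map number) (upTo-∷ʳ (suc n))))))))
  where
  null : ∀ s → F-fuel (suc n) s α ≡ F₀ (suc n)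
  null zero = refl
  null (suc s) rewrite eq = refl

F-forest : ∀ n (α : Germ (suc n)) → F (suc n) α ≡ number 0 ∷ enc (forest (suc n) α)
F-forest n (α , r) = F-fuel-forest n (Vec.sum α) α r refl

-- Shapes, Dyck words and the cycle lemma

word : Forest → List Bool
word []               = []
word (node _ cs ∷ ts) = word ts ++ false ∷ word cs ++ [ true ]

word-++ : ∀ f g → word (f ++ g) ≡ word g ++ word f
word-++ []               g = sym (++-identityʳ (word g))
word-++ (node x cs ∷ ts) g = trans (cong (_++ false ∷ word cs ++ [ true ]) (word-++ ts g)) (++-assoc (word g) (word ts) _)

map-bit-enc : ∀ f → map bit (enc f) ≡ word f
map-bit-enc []               = refl
map-bit-enc (node x cs ∷ ts) = trans (map-++ bit (enc ts) _) (cong₂ _++_ (map-bit-enc ts)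
  (cong (false ∷_) (trans (map-++ bit (enc cs) _) (cong (_++ [ true ]) (map-bit-enc cs)))))

θ-forest : ∀ n α → θ (suc n) α ≡ false ∷ word (forest (suc n) α)
θ-forest n α = trans (cong (map bit) (F-forest n α)) (cong (false ∷_) (map-bit-enc (forest (suc n) α)))

strip : Forest → Forest
strip []               = []
strip (node _ cs ∷ ts) = node 0 (strip cs) ∷ strip ts

infix 4 _≅_
_≅_ : Forest → Forest → Set
f ≅ g = strip f ≡ strip g

word-strip : ∀ f → word (strip f) ≡ word f
word-strip []               = refl
word-strip (node _ cs ∷ ts) = cong₂ (λ u v → u ++ false ∷ v ++ [ true ]) (word-strip ts) (word-strip cs)

≅⇒word : ∀ f g → f ≅ g → word f ≡ word g
≅⇒word f g eq = trans (sym (word-strip f)) (trans (cong word eq) (word-strip g))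

-- A stack parser: `s` holds the finished trees at the current depth, `st` those at the enclosing
-- depths. It inverts `word` up to labels, so that bits determine shapes.
parse : Forest → List Forest → List Bool → Forest
parse s  st       []          = s
parse s  st       (false ∷ w) = parse [] (s ∷ st) w
parse s  []       (true ∷ w)  = s
parse cs (s ∷ st) (true ∷ w)  = parse (node 0 cs ∷ s) st w

parse-word : ∀ f s st w → parse s st (word f ++ w) ≡ parse (strip f ++ s) st w
parse-word []               s st w = refl
parse-word (node _ cs ∷ ts) s st w = begin
  parse s st ((word ts ++ false ∷ word cs ++ [ true ]) ++ w)
    ≡⟨ cong (parse s st) (trans (++-assoc (word ts) _ w) (cong (λ u → word ts ++ false ∷ u) (++-assoc (word cs) [ true ] w))) ⟩
  parse s st (word ts ++ false ∷ word cs ++ true ∷ w)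
    ≡⟨ parse-word ts s st _ ⟩
  parse [] ((strip ts ++ s) ∷ st) (word cs ++ true ∷ w)
    ≡⟨ parse-word cs [] _ _ ⟩
  parse (node 0 (strip cs ++ []) ∷ strip ts ++ s) st w
    ≡⟨ cong (λ ds → parse (node 0 ds ∷ strip ts ++ s) st w) (++-identityʳ (strip cs)) ⟩
  parse (node 0 (strip cs) ∷ strip ts ++ s) st w ∎
  where open ≡-Reasoning

parse-word₀ : ∀ f → parse [] [] (word f) ≡ strip f
parse-word₀ f = trans (cong (parse [] []) (sym (++-identityʳ (word f)))) (trans (parse-word f [] [] []) (++-identityʳ (strip f)))

word⇒≅ : ∀ f g → word f ≡ word g → f ≅ g
word⇒≅ f g eq = trans (sym (parse-word₀ f)) (trans (cong (parse [] []) eq) (parse-word₀ g))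

strip-++ : ∀ f g → strip (f ++ g) ≡ strip f ++ strip g
strip-++ []               g = refl
strip-++ (node _ cs ∷ ts) g = cong (node 0 (strip cs) ∷_) (strip-++ ts g)

strip-take : ∀ a f → strip (take a f) ≡ take a (strip f)
strip-take zero    f                = refl
strip-take (suc a) []               = refl
strip-take (suc a) (node _ cs ∷ ts) = cong (node 0 (strip cs) ∷_) (strip-take a ts)

strip-drop : ∀ a f → strip (drop a f) ≡ drop a (strip f)
strip-drop zero    f                = refl
strip-drop (suc a) []               = refl
strip-drop (suc a) (node _ cs ∷ ts) = strip-drop a ts

length-strip : ∀ f → length (strip f) ≡ length f
length-strip []               = refl
length-strip (node _ cs ∷ ts) = cong suc (length-strip ts)

size-strip : ∀ f → size (strip f) ≡ size f
size-strip []               = refl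
size-strip (node _ cs ∷ ts) = cong suc (cong₂ _+_ (size-strip cs) (size-strip ts))

strip-pop : ∀ f → strip (pop f) ≡ pop (strip f)
strip-pop []               = refl
strip-pop (node _ cs ∷ ts) = strip-++ ts cs

strip-pops : ∀ n f → strip (pops n f) ≡ pops n (strip f)
strip-pops zero    f = refl
strip-pops (suc n) f = trans (strip-pops n (pop f)) (cong (pops n) (strip-pop f))

≅-length : ∀ f g → f ≅ g → length f ≡ length g
≅-length f g eq = trans (sym (length-strip f)) (trans (cong length eq) (length-strip g))

≅-size : ∀ f g → f ≅ g → size f ≡ size g
≅-size f g eq = trans (sym (size-strip f)) (trans (cong size eq) (size-strip g))

≅-pops : ∀ n f g → f ≅ g → pops n f ≅ pops n g
≅-pops n f g eq = trans (strip-pops n f) (trans (cong (pops n) eq) (sym (strip-pops n g)))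

≅-grow : ∀ x y a f g → f ≅ g → grow x a f ≅ grow y a g
≅-grow x y a f g eq = cong₂ (λ u v → node 0 u ∷ v)
  (trans (strip-drop a f) (trans (cong (drop a) eq) (sym (strip-drop a g))))
  (trans (strip-take a f) (trans (cong (take a) eq) (sym (strip-take a g))))

≅-forestFrom : ∀ {n} f g (as : Vec ℕ n) → f ≅ g → forestFrom f as ≅ forestFrom g as
≅-forestFrom         f g []       eq = eq
≅-forestFrom {suc n} f g (a ∷ as) eq = ≅-forestFrom _ _ as (≅-grow (suc n) (suc n) a f g eq)

restricted-grow : ∀ {n a x f} {as : Vec ℕ n} → a ≤ length f → Restricted (suc a) as → Restricted (length (grow x a f)) as
restricted-grow {x = x} {f} {as} a≤ = subst (λ b → Restricted b as) (sym (length-grow x f a≤))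

-- Popping the later entries returns the forest grown with the first entry, whose width is that
-- entry plus one.
forestFrom-injective : ∀ {n} f g (as bs : Vec ℕ n) → Restricted (length f) as → Restricted (length g) bs →
  forestFrom f as ≅ forestFrom g bs → as ≡ bs
forestFrom-injective f g [] [] _ _ _ = refl
forestFrom-injective {suc n} f g (a ∷ as) (b ∷ bs) (a≤ ∷ r) (b≤ ∷ s) eq = cong₂ _∷_
  (suc-injective (trans (sym (length-grow (suc n) f a≤)) (trans (≅-length (grow (suc n) a f) (grow (suc n) b g) grown) (length-grow (suc n) g b≤))))
  (forestFrom-injective (grow (suc n) a f) (grow (suc n) b g) as bs (restricted-grow {x = suc n} {f} a≤ r) (restricted-grow {x = suc n} {g} b≤ s) eq)
  where
  grown : grow (suc n) a f ≅ grow (suc n) b g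
  grown = subst₂ _≅_ (pops-forestFrom _ as) (pops-forestFrom _ bs) (≅-pops n (forestFrom (grow (suc n) a f) as) (forestFrom (grow (suc n) b g) bs) eq)

germ-≡ : ∀ {b n} (α β : RestrictedString b n) → string α ≡ string β → α ≡ β
germ-≡ (α , r) (_ , s) refl = cong (α ,_) (restricted-irrelevant r s)

forest-injective : ∀ n (α β : Germ (suc n)) → forest (suc n) α ≅ forest (suc n) β → α ≡ β
forest-injective n α β eq = germ-≡ α β (forestFrom-injective leaf leaf (string α) (string β) (restricted α) (restricted β) eq)
  where leaf = [ node (suc n) [] ]

-- Induction on the size by popping, with `as` collecting the entries found so far. The number of
-- trees beside the popped one is the next entry; it obeys its bound because all these trees remain
-- after the pop.
forestFrom-surjective : ∀ m {n} f (as : Vec ℕ n) → size f ≡ suc m → Restricted (length f) as → ∀ {N} → m + n ≡ N →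
  Σ[ β ∈ RestrictedString 1 N ] forestFrom [ node (suc N) [] ] (string β) ≅ forestFrom f as
forestFrom-surjective zero (node x [] ∷ []) as sz r refl = (as , r) , ≅-forestFrom _ _ as refl
forestFrom-surjective zero (node x [] ∷ node _ _ ∷ ts) as () r refl
forestFrom-surjective zero (node x (node _ _ ∷ cs) ∷ ts) as () r refl
forestFrom-surjective (suc m) {n} (node x cs ∷ ts) as sz r eq
  with forestFrom-surjective m (ts ++ cs) (length ts ∷ as)
         (suc-injective (trans (weight-pop (const 1) x cs ts) sz))
         (≤-trans (m≤m+n _ (length cs)) (≤-reflexive (sym (length-++ ts))) ∷ r) (trans (+-suc m n) eq)
... | β , β≅ = β , trans β≅ (≅-forestFrom _ _ as
    (cong₂ (λ u v → node 0 (strip u) ∷ strip v) (drop-length ts cs) (take-length ts cs)))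

forest-surjective : ∀ n f → size f ≡ suc n → Σ[ β ∈ Germ (suc n) ] forest (suc n) β ≅ f
forest-surjective n f sz = forestFrom-surjective n f [] sz [] (+-identityʳ n)

falses trues : List Bool → ℕ
falses []          = 0
falses (false ∷ w) = suc (falses w)
falses (true ∷ w)  = falses w
trues []          = 0
trues (false ∷ w) = trues w
trues (true ∷ w)  = suc (trues w)

falses-++ : ∀ u v → falses (u ++ v) ≡ falses u + falses v
falses-++ []          v = refl
falses-++ (false ∷ u) v = cong suc (falses-++ u v)
falses-++ (true ∷ u)  v = falses-++ u v

trues-++ : ∀ u v → trues (u ++ v) ≡ trues u + trues v
trues-++ []          v = refl
trues-++ (false ∷ u) v = trues-++ u v
trues-++ (true ∷ u)  v = cong suc (trues-++ u v)

Ballot : ℕ → List Bool → Set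
Ballot h       []          = ⊤
Ballot h       (false ∷ w) = Ballot (suc h) w
Ballot zero    (true ∷ w)  = ⊥
Ballot (suc h) (true ∷ w)  = Ballot h w

ballot-prefix : ∀ h u v → Ballot h (u ++ v) → trues u ≤ h + falses u
ballot-prefix h       []          v b = z≤n
ballot-prefix h       (false ∷ u) v b = ≤-trans (ballot-prefix (suc h) u v b) (≤-reflexive (sym (+-suc h _)))
ballot-prefix (suc h) (true ∷ u)  v b = s≤s (ballot-prefix h u v b)

word-ballot : ∀ f h w → Ballot h w → Ballot h (word f ++ w)
word-ballot []               h w b = b
word-ballot (node _ cs ∷ ts) h w b = subst (Ballot h) (sym (++-assoc (word ts) _ w))
  (word-ballot ts h _ (subst (Ballot (suc h)) (sym (++-assoc (word cs) _ w)) (word-ballot cs (suc h) _ b)))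

word-balanced : ∀ f → trues (word f) ≡ falses (word f)
word-balanced []               = refl
word-balanced (node _ cs ∷ ts) = begin
  trues (word ts ++ false ∷ word cs ++ [ true ])
    ≡⟨ trans (trues-++ (word ts) _) (cong (trues (word ts) +_) (trans (trues-++ (word cs) _) (+-comm _ 1))) ⟩
  trues (word ts) + suc (trues (word cs))
    ≡⟨ cong₂ (λ m n → m + suc n) (word-balanced ts) (word-balanced cs) ⟩
  falses (word ts) + suc (falses (word cs))
    ≡⟨ sym (trans (falses-++ (word ts) _) (cong (λ n → falses (word ts) + suc n) (trans (falses-++ (word cs) _) (+-identityʳ _)))) ⟩
  falses (word ts ++ false ∷ word cs ++ [ true ]) ∎
  where open ≡-Reasoning

proper-prefix : ∀ f (b : Bool) (u v : List Bool) → false ∷ word f ≡ (b ∷ u) ++ v → trues (b ∷ u) < falses (b ∷ u)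
proper-prefix f true  u v ()
proper-prefix f false u v eq = s≤s (ballot-prefix 0 u v
  (subst (Ballot 0) (trans (++-identityʳ (word f)) (∷-injectiveʳ eq)) (word-ballot f 0 [] tt)))

-- The cycle lemma: a proper rotation would split the word into two parts,
-- each of which has more zeros than ones, but the total excess is 1.
rotation-unique : ∀ f g u v → false ∷ word f ≡ u ++ v → false ∷ word g ≡ v ++ u → word f ≡ word g
rotation-unique f g []      v       p q = ∷-injectiveʳ (trans p (trans (sym (++-identityʳ v)) (sym q)))
rotation-unique f g (b ∷ u) []      p q = ∷-injectiveʳ (trans p (trans (++-identityʳ (b ∷ u)) (sym q)))
rotation-unique f g (b ∷ u) (c ∷ v) p q = contradiction (begin-strict
  suc (trues (word f))                 ≡⟨ cong suc (trans (cong trues p) (trues-++ (b ∷ u) (c ∷ v))) ⟩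
  suc (trues (b ∷ u)) + trues (c ∷ v)  <⟨ +-mono-≤-< (proper-prefix f b u (c ∷ v) p) (proper-prefix g c v (b ∷ u) q) ⟩
  falses (b ∷ u) + falses (c ∷ v)      ≡⟨ sym (trans (cong falses p) (falses-++ (b ∷ u) (c ∷ v))) ⟩
  suc (falses (word f))                ≡⟨ cong suc (sym (word-balanced f)) ⟩
  suc (trues (word f))                 ∎) (<-irrefl refl)
  where open ≤-Reasoning

-- Levi's lemma for words.
++-split : ∀ {A : Set} (u v x y : List A) → u ++ v ≡ x ++ y →
  (∃[ z ] u ≡ x ++ z × y ≡ z ++ v) ⊎ (∃[ z ] x ≡ u ++ z × v ≡ z ++ y)
++-split u       v []      y eq = inj₁ (u , refl , sym eq)
++-split []      v (b ∷ x) y eq = inj₂ (b ∷ x , refl , eq)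
++-split (a ∷ u) v (b ∷ x) y eq with ∷-injective eq
... | refl , eq′ with ++-split u v x y eq′
...   | inj₁ (z , refl , p) = inj₁ (z , refl , p)
...   | inj₂ (z , refl , p) = inj₂ (z , refl , p)

-- Comparing the two cuts of `w` by Levi's lemma shows each word to be a rotation of the other, and
-- the cycle lemma applies.
translate-unique : ∀ f g w → CyclicTranslate w (false ∷ word f) → CyclicTranslate w (false ∷ word g) → word f ≡ word g
translate-unique f g w (s , p) (t , q) = go (++-split y₁ x₁ y₂ x₂ (trans (sym p) q))
  where
  x₁ = take (toℕ s) (false ∷ word f)
  y₁ = drop (toℕ s) (false ∷ word f)
  x₂ = take (toℕ t) (false ∷ word g)
  y₂ = drop (toℕ t) (false ∷ word g)
  v₁ : false ∷ word f ≡ x₁ ++ y₁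
  v₁ = sym (take++drop≡id (toℕ s) _)
  v₂ : false ∷ word g ≡ x₂ ++ y₂
  v₂ = sym (take++drop≡id (toℕ t) _)
  go : _ → word f ≡ word g
  go (inj₁ (z , eq₁ , eq₂)) = rotation-unique f g (x₁ ++ y₂) z
    (trans v₁ (trans (cong (x₁ ++_) eq₁) (sym (++-assoc x₁ y₂ z))))
    (trans v₂ (trans (cong (_++ y₂) eq₂) (++-assoc z x₁ y₂)))
  go (inj₂ (z , eq₁ , eq₂)) = sym (rotation-unique g f (x₂ ++ y₁) z
    (trans v₂ (trans (cong (x₂ ++_) eq₁) (sym (++-assoc x₂ y₁ z))))
    (trans v₁ (trans (cong (_++ y₁) eq₂) (++-assoc z x₂ y₁))))

rotate : ∀ x y → 0 < length (x ++ y) → CyclicTranslate (y ++ x) (x ++ y)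
rotate x []      0< = fromℕ< 0< , subst (λ s → x ≡ drop s (x ++ []) ++ take s (x ++ [])) (sym (Fin.toℕ-fromℕ< 0<))
  (trans (sym (++-identityʳ x)) (sym (++-identityʳ _)))
rotate x (b ∷ y) 0< = fromℕ< x< , subst (λ s → b ∷ y ++ x ≡ drop s (x ++ b ∷ y) ++ take s (x ++ b ∷ y)) (sym (Fin.toℕ-fromℕ< x<))
  (sym (cong₂ _++_ (drop-length x (b ∷ y)) (take-length x (b ∷ y))))
  where
  x< : length x < length (x ++ b ∷ y)
  x< = ≤-trans (m≤m+n _ (length y)) (≤-reflexive (trans (sym (+-suc (length x) _)) (sym (length-++ x))))

find-unique : ∀ {A : Set} {P : A → Set} (P? : ∀ x → Dec (P x)) d {y} xs → y ∈ xs → P y → (∀ x → P x → x ≡ y) →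
  fromMaybe d (find P? xs) ≡ y
find-unique P? d (x ∷ xs) y∈ py uniq with P? x
... | yes px = uniq x px
find-unique P? d (x ∷ xs) (here refl) py uniq | no ¬px = contradiction py ¬px
find-unique P? d (x ∷ xs) (there y∈)  py uniq | no ¬px = find-unique P? d xs y∈ py uniq

-- Any germ passing the test has the word of `γ` by the cycle lemma, hence the same shape, hence the
-- same entries.
neighbour-unique : ∀ n p (α γ : Germ (suc n)) →
  CyclicTranslate (complementedReversal (θ-flipped (suc n) p α)) (false ∷ word (forest (suc n) γ)) →
  neighbour (suc n) p α ≡ γ
neighbour-unique n p α γ tr = find-unique (λ γ → cyclicTranslate? flipped (θ (suc n) γ)) (nullGerm (suc n)) (germs (suc n))
  (germs-complete (suc n) γ) (subst (CyclicTranslate flipped) (sym (θ-forest n γ)) tr)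
  λ β trβ → forest-injective n β γ (word⇒≅ (forest (suc n) β) (forest (suc n) γ) (translate-unique (forest (suc n) β) (forest (suc n) γ) flipped
    (subst (CyclicTranslate flipped) (θ-forest n β) trβ) tr))
  where flipped = complementedReversal (θ-flipped (suc n) p α)

-- Colour changes along a path

mirror : Forest → Forest
mirror []               = []
mirror (node x cs ∷ ts) = mirror ts ++ [ node x (mirror cs) ]

kids : Forest → Forest
kids []               = []
kids (node _ cs ∷ ts) = cs ++ kids ts

level : ℕ → Forest → Forest
level zero    f = f
level (suc n) f = level n (kids f)

mirror-++ : ∀ f g → mirror (f ++ g) ≡ mirror g ++ mirror f
mirror-++ []               g = sym (++-identityʳ (mirror g))
mirror-++ (node x cs ∷ ts) g = trans (cong (_++ [ node x (mirror cs) ]) (mirror-++ ts g)) (++-assoc (mirror g) (mirror ts) _)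

mirror-involutive : ∀ f → mirror (mirror f) ≡ f
mirror-involutive []               = refl
mirror-involutive (node x cs ∷ ts) = trans (mirror-++ (mirror ts) _)
  (cong₂ (λ u v → node x u ∷ v) (mirror-involutive cs) (mirror-involutive ts))

kids-++ : ∀ f g → kids (f ++ g) ≡ kids f ++ kids g
kids-++ []               g = refl
kids-++ (node _ cs ∷ ts) g = trans (cong (cs ++_) (kids-++ ts g)) (sym (++-assoc cs (kids ts) _))

kids-mirror : ∀ f → kids (mirror f) ≡ mirror (kids f)
kids-mirror []               = refl
kids-mirror (node x cs ∷ ts) = begin
  kids (mirror ts ++ [ node x (mirror cs) ])  ≡⟨ kids-++ (mirror ts) _ ⟩
  kids (mirror ts) ++ mirror cs ++ []         ≡⟨ cong₂ _++_ (kids-mirror ts) (++-identityʳ (mirror cs)) ⟩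
  mirror (kids ts) ++ mirror cs               ≡⟨ sym (mirror-++ cs (kids ts)) ⟩
  mirror (cs ++ kids ts)                      ∎
  where open ≡-Reasoning

level-++ : ∀ n f g → level n (f ++ g) ≡ level n f ++ level n g
level-++ zero    f g = refl
level-++ (suc n) f g = trans (cong (level n) (kids-++ f g)) (level-++ n (kids f) (kids g))

level-mirror : ∀ n f → level n (mirror f) ≡ mirror (level n f)
level-mirror zero    f = refl
level-mirror (suc n) f = trans (cong (level n) (kids-mirror f)) (level-mirror n (kids f))

weight-mirror : ∀ w f → weight w (mirror f) ≡ weight w f
weight-mirror w []               = refl
weight-mirror w (node x cs ∷ ts) = trans (weight-++ w (mirror ts) _)
  (trans (cong₂ (λ m n → m + (w x + n + 0)) (weight-mirror w ts) (weight-mirror w cs))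
    (trans (cong (weight w ts +_) (+-identityʳ _)) (+-comm (weight w ts) _)))

length-mirror : ∀ f → length (mirror f) ≡ length f
length-mirror []               = refl
length-mirror (node _ cs ∷ ts) = trans (length-++ (mirror ts)) (trans (+-comm _ 1) (cong suc (length-mirror ts)))

-- A frame records the siblings to the left of a node, its label, and the
-- siblings to the right of the next node on the path (or, at the end of
-- the path, the children of the node).  With this shift of the right
-- siblings, colour changes act on each frame separately, see turn.
record Frame : Set where
  constructor frame
  field
    left  : Forest
    label : ℕ
    right : Forest

record Zipper : Set where
  constructor zipper
  field
    outer : Forest
    path  : List Frame
    final : Frame

close : Forest → List Frame → Frame → Forest
close q []                (frame l x r) = q ++ node x r ∷ l
close q (frame l x r ∷ z) e             = q ++ node x (close r z e) ∷ l

plug : Zipper → Forest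
plug (zipper q z e) = close q z e

label : Zipper → ℕ
label (zipper _ _ e) = Frame.label e

reflect : Frame → Frame
reflect (frame l x r) = frame (mirror r) x (mirror l)

turn : Zipper → Zipper
turn (zipper q z e) = zipper (mirror q) (map reflect z) (reflect e)

reflect-involutive : ∀ e → reflect (reflect e) ≡ e
reflect-involutive (frame l x r) = cong₂ (λ l r → frame l x r) (mirror-involutive l) (mirror-involutive r)

turn-involutive : ∀ Z → turn (turn Z) ≡ Z
turn-involutive (zipper q z e) rewrite mirror-involutive q | reflect-involutive e = cong (λ z → zipper q z e)
  (trans (sym (map-∘ z)) (trans (map-cong reflect-involutive z) (map-id z)))

-- queue Z is the breadth-first queue right after the node at the end of the
-- path is popped, see reached-queue; it is invariant under turn up to mirror.
around : Forest → List Frame → Forest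
around m []                = m
around m (frame l _ r ∷ z) = around (level (suc (length z)) l ++ m ++ level (suc (length z)) r) z

waiting : Zipper → Forest
waiting (zipper q z (frame l _ _)) = l ++ around (level (suc (length z)) q) z

queue : Zipper → Forest
queue Z@(zipper _ _ (frame _ _ r)) = waiting Z ++ r

pops-length : ∀ f g → pops (length f) (f ++ g) ≡ g ++ kids f
pops-length []               g = sym (++-identityʳ g)
pops-length (node _ cs ∷ ts) g = trans (cong (pops (length ts)) (++-assoc ts g cs))
  (trans (pops-length ts (g ++ cs)) (++-assoc g cs (kids ts)))

around-cong : ∀ {m m′} z → m ≡ m′ → around m z ≡ around m′ z
around-cong z = cong (λ m → around m z)

-- `b` and `a` are the trees of the current level to the right and to the left of the siblings on
-- the path. Descending one frame pops this whole level; the children of `b` and `q` are then to the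
-- right, those of the left siblings and of `a` to the left.
reach : ∀ b q z l x r a → ∃[ i ] pops i (b ++ close q z (frame l x r) ++ a) ≡
  node x r ∷ l ++ around (level (length z) a ++ level (suc (length z)) b ++ level (suc (length z)) q) z
reach b q [] l x r a = length (b ++ q) , (begin
  pops (length (b ++ q)) (b ++ (q ++ node x r ∷ l) ++ a)
    ≡⟨ cong (pops (length (b ++ q))) (trans (cong (b ++_) (++-assoc q _ a)) (sym (++-assoc b q _))) ⟩
  pops (length (b ++ q)) ((b ++ q) ++ node x r ∷ l ++ a)
    ≡⟨ pops-length (b ++ q) _ ⟩
  node x r ∷ (l ++ a) ++ kids (b ++ q)
    ≡⟨ cong (node x r ∷_) (trans (++-assoc l a _) (cong (λ k → l ++ a ++ k) (kids-++ b q))) ⟩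
  node x r ∷ l ++ a ++ kids b ++ kids q ∎)
  where open ≡-Reasoning
reach b q (frame l′ y r′ ∷ z) l x r a with reach (kids b ++ kids q) r′ z l x r (kids l′ ++ kids a)
... | i , eq = length all + i , (begin
  pops (length all + i) all
    ≡⟨ trans (pops-+ (length all) i all) (cong (λ f → pops i (pops (length all) f)) (sym (++-identityʳ all))) ⟩
  pops i (pops (length all) (all ++ []))
    ≡⟨ cong (pops i) (trans (pops-length all []) kids-all) ⟩
  pops i ((kids b ++ kids q) ++ close r′ z (frame l x r) ++ kids l′ ++ kids a)
    ≡⟨ eq ⟩
  node x r ∷ l ++ around (level n (kids l′ ++ kids a) ++ level (suc n) (kids b ++ kids q) ++ level (suc n) r′) z
    ≡⟨ cong (λ f → node x r ∷ l ++ f) (around-cong z regroup) ⟩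
  node x r ∷ l ++ around (level (suc n) a ++ level (suc (suc n)) b ++ level (suc (suc n)) q) (frame l′ y r′ ∷ z) ∎)
  where
  open ≡-Reasoning
  n = length z
  t = node y (close r′ z (frame l x r))
  all = b ++ (q ++ t ∷ l′) ++ a
  kids-all : kids all ≡ (kids b ++ kids q) ++ close r′ z (frame l x r) ++ kids l′ ++ kids a
  kids-all = begin
    kids all                                                    ≡⟨ kids-++ b _ ⟩
    kids b ++ kids ((q ++ t ∷ l′) ++ a)                         ≡⟨ cong (λ f → kids b ++ kids f) (++-assoc q _ a) ⟩
    kids b ++ kids (q ++ t ∷ l′ ++ a)                           ≡⟨ cong (kids b ++_) (kids-++ q _) ⟩
    kids b ++ kids q ++ close r′ z (frame l x r) ++ kids (l′ ++ a) ≡⟨ sym (++-assoc (kids b) (kids q) _) ⟩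
    (kids b ++ kids q) ++ close r′ z (frame l x r) ++ kids (l′ ++ a)
      ≡⟨ cong (λ f → (kids b ++ kids q) ++ close r′ z (frame l x r) ++ f) (kids-++ l′ a) ⟩
    (kids b ++ kids q) ++ close r′ z (frame l x r) ++ kids l′ ++ kids a ∎
  regroup : level n (kids l′ ++ kids a) ++ level (suc n) (kids b ++ kids q) ++ level (suc n) r′ ≡
    level (suc n) l′ ++ (level (suc n) a ++ level (suc (suc n)) b ++ level (suc (suc n)) q) ++ level (suc n) r′
  regroup = begin
    level n (kids l′ ++ kids a) ++ level (suc n) (kids b ++ kids q) ++ level (suc n) r′
      ≡⟨ cong₂ (λ u v → u ++ v ++ level (suc n) r′) (level-++ n (kids l′) (kids a)) (level-++ (suc n) (kids b) (kids q)) ⟩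
    (level (suc n) l′ ++ level (suc n) a) ++ (level (suc (suc n)) b ++ level (suc (suc n)) q) ++ level (suc n) r′
      ≡⟨ ++-assoc (level (suc n) l′) _ _ ⟩
    level (suc n) l′ ++ level (suc n) a ++ (level (suc (suc n)) b ++ level (suc (suc n)) q) ++ level (suc n) r′
      ≡⟨ cong (level (suc n) l′ ++_) (sym (++-assoc (level (suc n) a) _ _)) ⟩
    level (suc n) l′ ++ (level (suc n) a ++ level (suc (suc n)) b ++ level (suc (suc n)) q) ++ level (suc n) r′ ∎

Reached : ℕ → Zipper → Set
Reached i Z@(zipper _ _ (frame _ x r)) = pops i (plug Z) ≡ node x r ∷ waiting Z

reached : ∀ Z → ∃[ i ] Reached i Z
reached (zipper q z (frame l x r)) with reach [] q z l x r []
... | i , eq = i , trans (cong (pops i) (sym (++-identityʳ _))) (trans eq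
  (cong (λ f → node x r ∷ l ++ f) (around-cong z
    (trans (cong (_++ level (suc n) [] ++ level (suc n) q) (level-[] n)) (cong (_++ level (suc n) q) (level-[] n))))))
  where
  n = length z
  level-[] : ∀ n → level n [] ≡ []
  level-[] zero    = refl
  level-[] (suc n) = level-[] n

reached-queue : ∀ i Z → Reached i Z → pops (suc i) (plug Z) ≡ queue Z
reached-queue i Z@(zipper _ _ (frame _ _ _)) eq = trans (pops-suc i (plug Z)) (cong pop eq)

reached-size : ∀ i Z → Reached i Z → suc i + size (queue Z) ≡ size (plug Z)
reached-size i Z@(zipper _ _ (frame _ x r)) eq = trans (sym (+-suc i _))
  (trans (cong (i +_) (weight-pop (const 1) x r (waiting Z))) (size-pops i (plug Z) eq))

-- Some index is known to reach the node, and the size of the queue leaves only one choice. The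
-- position can thus be found by counting alone.
size-reached : ∀ i Z → suc i + size (queue Z) ≡ size (plug Z) → Reached i Z
size-reached i Z eq with reached Z
... | j , r = subst (λ i → Reached i Z) (suc-injective (+-cancelʳ-≡ (size (queue Z)) _ _
  (trans (reached-size j Z r) (sym eq)))) r

-- Owing to the shifted right siblings, both sides of a frame lie equally many levels above the
-- nodes that they contribute, so exchanging them mirrors the nested whole.
mirror-around : ∀ m z → mirror (around m z) ≡ around (mirror m) (map reflect z)
mirror-around m []                = refl
mirror-around m (frame l _ r ∷ z) = trans (mirror-around _ z) (around-cong (map reflect z) (begin
  mirror (level n l ++ m ++ level n r)
    ≡⟨ trans (mirror-++ (level n l) _) (trans (cong (_++ mirror (level n l)) (mirror-++ m _)) (++-assoc (mirror (level n r)) _ _)) ⟩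
  mirror (level n r) ++ mirror m ++ mirror (level n l)
    ≡⟨ sym (cong₂ (λ u v → u ++ mirror m ++ v) (level-mirror n r) (level-mirror n l)) ⟩
  level n (mirror r) ++ mirror m ++ level n (mirror l)
    ≡⟨ cong (λ n → level (suc n) (mirror r) ++ mirror m ++ level (suc n) (mirror l)) (sym (length-map reflect z)) ⟩
  level (suc (length (map reflect z))) (mirror r) ++ mirror m ++ level (suc (length (map reflect z))) (mirror l) ∎))
  where
  open ≡-Reasoning
  n = suc (length z)

queue-turn : ∀ Z → queue (turn Z) ≡ mirror (queue Z)
queue-turn (zipper q z (frame l x r)) = sym (begin
  mirror ((l ++ around (level n q) z) ++ r)
    ≡⟨ trans (mirror-++ (l ++ around (level n q) z) r) (cong (mirror r ++_) (mirror-++ l _)) ⟩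
  mirror r ++ mirror (around (level n q) z) ++ mirror l
    ≡⟨ cong (λ f → mirror r ++ f ++ mirror l) (trans (mirror-around _ z) (around-cong (map reflect z)
         (trans (sym (level-mirror n q)) (cong (λ n → level (suc n) (mirror q)) (sym (length-map reflect z)))))) ⟩
  mirror r ++ around (level (suc (length (map reflect z))) (mirror q)) (map reflect z) ++ mirror l
    ≡⟨ sym (++-assoc (mirror r) _ (mirror l)) ⟩
  (mirror r ++ around (level (suc (length (map reflect z))) (mirror q)) (map reflect z)) ++ mirror l ∎)
  where
  open ≡-Reasoning
  n = suc (length z)

load : (ℕ → ℕ) → List Frame → Frame → ℕ
load w []                (frame l x r) = w x + weight w r + weight w l
load w (frame l x r ∷ z) e             = w x + (weight w r + load w z e) + weight w l

weight-close : ∀ w q z e → weight w (close q z e) ≡ weight w q + load w z e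
weight-close w q []                (frame l x r) = weight-++ w q _
weight-close w q (frame l x r ∷ z) e = trans (weight-++ w q _)
  (cong (λ n → weight w q + (w x + n + weight w l)) (weight-close w r z e))

load-reflect : ∀ w z e → load w (map reflect z) (reflect e) ≡ load w z e
load-reflect w [] (frame l x r) = trans
  (cong₂ (λ m n → w x + m + n) (weight-mirror w l) (weight-mirror w r))
  (solve 3 (λ a b c → a :+ b :+ c := a :+ c :+ b) refl (w x) (weight w l) (weight w r))
  where open +-*-Solver
load-reflect w (frame l x r ∷ z) e = trans
  (cong₂ (λ m n → w x + m + n) (cong₂ _+_ (weight-mirror w l) (load-reflect w z e)) (weight-mirror w r))
  (solve 4 (λ a b c d → a :+ (b :+ d) :+ c := a :+ (c :+ d) :+ b) refl (w x) (weight w l) (weight w r) (load w z e))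
  where open +-*-Solver

weight-turn : ∀ w Z → weight w (plug (turn Z)) ≡ weight w (plug Z)
weight-turn w (zipper q z e) = trans (weight-close w (mirror q) (map reflect z) (reflect e))
  (trans (cong₂ _+_ (weight-mirror w q) (load-reflect w z e)) (sym (weight-close w q z e)))

-- Neither the queue nor the forest changes its size, and these sizes fix the position.
reached-turn : ∀ i Z → Reached i Z → Reached i (turn Z)
reached-turn i Z r = size-reached i (turn Z) (trans
  (cong (suc i +_) (trans (cong size (queue-turn Z)) (weight-mirror (const 1) (queue Z))))
  (trans (reached-size i Z r) (sym (weight-turn (const 1) Z))))

-- Passing to unlabelled shapes

strip-mirror : ∀ f → strip (mirror f) ≡ mirror (strip f)
strip-mirror []               = refl
strip-mirror (node _ cs ∷ ts) = trans (strip-++ (mirror ts) _)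
  (cong₂ (λ u v → u ++ [ node 0 v ]) (strip-mirror ts) (strip-mirror cs))

strip-kids : ∀ f → strip (kids f) ≡ kids (strip f)
strip-kids []               = refl
strip-kids (node _ cs ∷ ts) = trans (strip-++ cs (kids ts)) (cong (strip cs ++_) (strip-kids ts))

strip-level : ∀ n f → strip (level n f) ≡ level n (strip f)
strip-level zero    f = refl
strip-level (suc n) f = trans (strip-level n (kids f)) (cong (level n) (strip-kids f))

stripFrame : Frame → Frame
stripFrame (frame l _ r) = frame (strip l) 0 (strip r)

stripZipper : Zipper → Zipper
stripZipper (zipper q z e) = zipper (strip q) (map stripFrame z) (stripFrame e)

strip-close : ∀ q z e → strip (close q z e) ≡ close (strip q) (map stripFrame z) (stripFrame e)
strip-close q []                (frame l _ r) = strip-++ q _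
strip-close q (frame l _ r ∷ z) e = trans (strip-++ q _) (cong (λ f → strip q ++ node 0 f ∷ strip l) (strip-close r z e))

strip-plug : ∀ Z → strip (plug Z) ≡ plug (stripZipper Z)
strip-plug (zipper q z e) = strip-close q z e

strip-around : ∀ m z → strip (around m z) ≡ around (strip m) (map stripFrame z)
strip-around m []                = refl
strip-around m (frame l _ r ∷ z) = trans (strip-around _ z) (around-cong (map stripFrame z)
  (trans (trans (strip-++ (level n l) _) (cong (strip (level n l) ++_) (strip-++ m _)))
    (trans (cong₂ (λ u v → u ++ strip m ++ v) (strip-level n l) (strip-level n r))
      (cong (λ n → level (suc n) (strip l) ++ strip m ++ level (suc n) (strip r)) (sym (length-map stripFrame z))))))
  where n = suc (length z)

strip-queue : ∀ Z → strip (queue Z) ≡ queue (stripZipper Z)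
strip-queue (zipper q z (frame l _ r)) = trans (strip-++ _ r) (cong (_++ strip r)
  (trans (strip-++ l _) (cong (strip l ++_) (trans (strip-around _ z) (around-cong (map stripFrame z)
    (trans (strip-level n q) (cong (λ n → level (suc n) (strip q)) (sym (length-map stripFrame z)))))))))
  where n = suc (length z)

strip-reflect : ∀ e → stripFrame (reflect e) ≡ reflect (stripFrame e)
strip-reflect (frame l _ r) = cong₂ (λ u v → frame u 0 v) (strip-mirror r) (strip-mirror l)

strip-turn : ∀ Z → stripZipper (turn Z) ≡ turn (stripZipper Z)
strip-turn (zipper q z e) rewrite strip-mirror q | strip-reflect e = cong (λ z → zipper (mirror (strip q)) z (reflect (stripFrame e)))
  (trans (sym (map-∘ z)) (trans (map-cong strip-reflect z) (map-∘ z)))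

strip-split : ∀ f q x cs l → strip f ≡ q ++ node x cs ∷ l →
  ∃[ q′ ] ∃[ y ] ∃[ ds ] ∃[ l′ ] f ≡ q′ ++ node y ds ∷ l′ × strip q′ ≡ q × x ≡ 0 × strip ds ≡ cs × strip l′ ≡ l
strip-split (node y ds ∷ ts) []      x cs l refl = [] , y , ds , ts , refl , refl , refl , refl , refl
strip-split (node y ds ∷ ts) (t ∷ q) x cs l eq with ∷-injective eq
... | refl , eq′ with strip-split ts q x cs l eq′
...   | q′ , y′ , ds′ , l′ , refl , refl , p = node y ds ∷ q′ , y′ , ds′ , l′ , refl , refl , p

-- Serves to find, in the forest of a germ with its own breadth-first labels, the path that an
-- exchange has produced with other labels.
lift : ∀ f q z e → strip f ≡ close q z e → ∃[ Z ] f ≡ plug Z × stripZipper Z ≡ zipper q z e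
lift f q [] (frame l x r) eq with strip-split f q x r l eq
... | q′ , y , r′ , l′ , refl , refl , refl , refl , refl = zipper q′ [] (frame l′ y r′) , refl , refl
lift f q (frame l x r ∷ z) e eq with strip-split f q x (close r z e) l eq
... | q′ , y , ds , l′ , refl , refl , refl , eq′ , refl with lift ds r z e eq′
...   | zipper r′ z′ e′ , refl , refl = zipper q′ (frame l′ y r′ ∷ z′) e′ , refl , refl

-- The neighbours of a germ

-- p labels the node at the end of the path, and no other node.
data Marks (p : ℕ) : Forest → List Frame → Frame → Set where
  here  : ∀ {q l r} → occurrences p q ≡ 0 → occurrences p r ≡ 0 → occurrences p l ≡ 0 →
          Marks p q [] (frame l p r)
  there : ∀ {q l x r z e} → occurrences p q ≡ 0 → x ≢ p → occurrences p l ≡ 0 → Marks p r z e →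
          Marks p q (frame l x r ∷ z) e

occurs-close : ∀ q z e → 1 ≤ occurrences (Frame.label e) (close q z e)
occurs-close q [] (frame l x r) = ≤-trans (occurrences-root x r l)
  (≤-trans (m≤n+m _ (occurrences x q)) (≤-reflexive (sym (weight-++ (δ x) q _))))
occurs-close q (frame l y r ∷ z) e = ≤-trans (occurs-close r z e) (≤-trans (m≤n+m _ (δ x y))
  (≤-trans (m≤m+n _ (occurrences x l)) (≤-trans (m≤n+m _ (occurrences x q)) (≤-reflexive (sym (weight-++ (δ x) q _))))))
  where x = Frame.label e

marks : ∀ q z e → occurrences (Frame.label e) (close q z e) ≤ 1 → Marks (Frame.label e) q z e
marks q [] (frame l x r) d = here
  (+≤1⇒≡0 (occ q) d′ root)
  (m+n≡0⇒n≡0 0 (+≤1⇒≡0 (occ r) (≤-trans (≤-reflexive (+-comm (occ r) _)) (≤-trans (m≤m+n _ (occ l)) below)) (≤-reflexive (sym (δ-refl x)))))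
  (+≤1⇒≡0 (occ l) (≤-trans (≤-reflexive (+-comm (occ l) _)) below) (≤-trans (≤-reflexive (sym (δ-refl x))) (m≤m+n _ (occ r))))
  where
  occ = occurrences x
  d′ : occ q + occ (node x r ∷ l) ≤ 1
  d′ = ≤-trans (≤-reflexive (sym (weight-++ (δ x) q _))) d
  root = occurrences-root x r l
  below = ≤-trans (m≤n+m _ (occ q)) d′
marks q (frame l y r ∷ z) e d = there
  (+≤1⇒≡0 (occ q) d′ (≤-trans inner (≤-trans (m≤n+m _ (δ x y)) (m≤m+n _ (occ l)))))
  (δ≡0 (+≤1⇒≡0 (δ x y) (≤-trans (m≤m+n _ (occ l)) below) inner))
  (+≤1⇒≡0 (occ l) (≤-trans (≤-reflexive (+-comm (occ l) _)) below) (≤-trans inner (m≤n+m _ (δ x y))))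
  (marks r z e (≤-trans (m≤n+m _ (δ x y)) (≤-trans (m≤m+n _ (occ l)) below)))
  where
  x = Frame.label e
  occ = occurrences x
  inner = occurs-close r z e
  d′ : occ q + occ (node y (close r z e) ∷ l) ≤ 1
  d′ = ≤-trans (≤-reflexive (sym (weight-++ (δ x) q _))) d
  below = ≤-trans (m≤n+m _ (occ q)) d′

close-∷ : ∀ t q z e → close (t ∷ q) z e ≡ t ∷ close q z e
close-∷ t q []      e = refl
close-∷ t q (_ ∷ z) e = refl

locate : ∀ p f → 1 ≤ occurrences p f → ∃[ Z ] plug Z ≡ f × label Z ≡ p
locate p (node x cs ∷ ts) 1≤ = go (positive (δ p x) (occurrences p cs) (occurrences p ts) 1≤)
  where
  positive : ∀ a b c → 1 ≤ a + b + c → a ≢ 0 ⊎ 1 ≤ b ⊎ 1 ≤ c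
  positive (suc a) b       c _ = inj₁ λ ()
  positive zero    (suc b) c _ = inj₂ (inj₁ (s≤s z≤n))
  positive zero    zero    c h = inj₂ (inj₂ h)
  go : _ → ∃[ Z ] plug Z ≡ node x cs ∷ ts × label Z ≡ p
  go (inj₁ δ≢0) with x ≟ p
  ... | yes x≡p = zipper [] [] (frame ts x cs) , refl , x≡p
  ... | no  x≢p = contradiction refl δ≢0
  go (inj₂ (inj₁ 1≤cs)) with locate p cs 1≤cs
  ... | zipper r z e , eq , l = zipper [] (frame ts x r ∷ z) e , cong (λ ds → node x ds ∷ ts) eq , l
  go (inj₂ (inj₂ 1≤ts)) with locate p ts 1≤ts
  ... | zipper q z e , eq , l = zipper (node x cs ∷ q) z e , trans (close-∷ _ q z e) (cong (node x cs ∷_) eq) , l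

-- The bits before the node at the end of the path, with the leading 0 of `F`. The `false` of a
-- frame opens the parent, which for the first frame is that 0.
leftWord : List Frame → Frame → List Bool
leftWord []                (frame l _ _) = false ∷ word l
leftWord (frame l _ _ ∷ z) e             = false ∷ word l ++ leftWord z e

rightWord : Forest → List Frame → Frame → List Bool
rightWord q []                (frame _ _ r) = word r ++ true ∷ word q
rightWord q (frame _ _ r ∷ z) e             = rightWord r z e ++ true ∷ word q

-- With `φ` equal to `setBitAt p` or to `bit`, one computation covers the flipped word of the source
-- and the plain word of the target.
module _ (φ : Entry → Bool) (p : ℕ) (φ-∗ : φ ∗ ≡ true) (φ-number : ∀ {x} → x ≢ p → φ (number x) ≡ false) where

  map-enc : ∀ f → occurrences p f ≡ 0 → map φ (enc f) ≡ word f
  map-enc []               _  = refl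
  map-enc (node x cs ∷ ts) o0 = trans (map-++ φ (enc ts) _) (cong₂ _++_
    (map-enc ts (m+n≡0⇒n≡0 (δ p x + occurrences p cs) o0))
    (cong₂ _∷_ (φ-number (δ≡0 (m+n≡0⇒m≡0 _ d+cs)))
      (trans (map-++ φ (enc cs) _) (cong₂ (λ u b → u ++ [ b ]) (map-enc cs (m+n≡0⇒n≡0 (δ p x) d+cs)) φ-∗))))
    where d+cs = m+n≡0⇒m≡0 (δ p x + occurrences p cs) o0

  map-enc-node : ∀ q x cs l → occurrences p q ≡ 0 → occurrences p l ≡ 0 →
    map φ (enc (q ++ node x cs ∷ l)) ≡ word l ++ φ (number x) ∷ map φ (enc cs) ++ true ∷ word q
  map-enc-node q x cs l q0 l0 = begin
    map φ (enc (q ++ node x cs ∷ l))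
      ≡⟨ cong (map φ) (trans (enc-++ q _) (trans (++-assoc (enc l) _ (enc q))
           (cong (λ u → enc l ++ number x ∷ u) (++-assoc (enc cs) [ ∗ ] (enc q))))) ⟩
    map φ (enc l ++ number x ∷ enc cs ++ ∗ ∷ enc q)
      ≡⟨ trans (map-++ φ (enc l) _) (cong (λ u → map φ (enc l) ++ φ (number x) ∷ u) (map-++ φ (enc cs) _)) ⟩
    map φ (enc l) ++ φ (number x) ∷ map φ (enc cs) ++ φ ∗ ∷ map φ (enc q)
      ≡⟨ cong₂ (λ u v → u ++ φ (number x) ∷ map φ (enc cs) ++ v) (map-enc l l0) (cong₂ _∷_ φ-∗ (map-enc q q0)) ⟩
    word l ++ φ (number x) ∷ map φ (enc cs) ++ true ∷ word q ∎
    where open ≡-Reasoning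

  map-enc-close : ∀ q z e → Marks p q z e →
    false ∷ map φ (enc (close q z e)) ≡ leftWord z e ++ φ (number p) ∷ rightWord q z e
  map-enc-close q [] (frame l _ r) (here q0 r0 l0) = cong (false ∷_) (trans (map-enc-node q p r l q0 l0)
    (cong (λ u → word l ++ φ (number p) ∷ u ++ true ∷ word q) (map-enc r r0)))
  map-enc-close q (frame l x r ∷ z) e (there q0 x≢p l0 m) = cong (false ∷_) (begin
    map φ (enc (q ++ node x (close r z e) ∷ l))
      ≡⟨ map-enc-node q x _ l q0 l0 ⟩
    word l ++ (φ (number x) ∷ map φ (enc (close r z e))) ++ true ∷ word q
      ≡⟨ cong (λ u → word l ++ u ++ true ∷ word q)
           (trans (cong (_∷ map φ (enc (close r z e))) (φ-number x≢p)) (map-enc-close r z e m)) ⟩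
    word l ++ (leftWord z e ++ φ (number p) ∷ rightWord r z e) ++ true ∷ word q
      ≡⟨ cong (word l ++_) (++-assoc (leftWord z e) _ _) ⟩
    word l ++ leftWord z e ++ φ (number p) ∷ rightWord r z e ++ true ∷ word q
      ≡⟨ sym (++-assoc (word l) (leftWord z e) _) ⟩
    (word l ++ leftWord z e) ++ φ (number p) ∷ rightWord q (frame l x r ∷ z) e ∎)
    where open ≡-Reasoning

reversal-++ : ∀ u v → complementedReversal (u ++ v) ≡ complementedReversal v ++ complementedReversal u
reversal-++ u v = trans (cong (map not) (reverse-++ u v)) (map-++ not (reverse v) (reverse u))

reversal-∷ : ∀ b u → complementedReversal (b ∷ u) ≡ complementedReversal u ++ [ not b ]
reversal-∷ b u = reversal-++ [ b ] u

reversal-∷-++ : ∀ u b v → complementedReversal (u ++ b ∷ v) ≡ complementedReversal v ++ not b ∷ complementedReversal u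
reversal-∷-++ u b v = trans (reversal-++ u (b ∷ v)) (trans (cong (_++ complementedReversal u) (reversal-∷ b v))
  (++-assoc (complementedReversal v) _ _))

reversal-word : ∀ f → complementedReversal (word f) ≡ word (mirror f)
reversal-word []               = refl
reversal-word (node x cs ∷ ts) = begin
  complementedReversal (word ts ++ false ∷ word cs ++ [ true ])
    ≡⟨ trans (reversal-++ (word ts) _) (cong (_++ complementedReversal (word ts)) (trans (reversal-∷ false (word cs ++ [ true ]))
         (cong (_++ [ true ]) (reversal-++ (word cs) [ true ])))) ⟩
  (false ∷ complementedReversal (word cs) ++ [ true ]) ++ complementedReversal (word ts)
    ≡⟨ cong₂ (λ u v → (false ∷ u ++ [ true ]) ++ v) (reversal-word cs) (reversal-word ts) ⟩
  word [ node x (mirror cs) ] ++ word (mirror ts)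
    ≡⟨ sym (word-++ (mirror ts) [ node x (mirror cs) ]) ⟩
  word (mirror ts ++ [ node x (mirror cs) ]) ∎
  where open ≡-Reasoning

reversal-rightWord : ∀ q z e →
  complementedReversal (rightWord q z e) ≡ word (mirror q) ++ leftWord (map reflect z) (reflect e)
reversal-rightWord q [] (frame _ _ r) = trans (reversal-∷-++ (word r) true (word q))
  (cong₂ (λ u v → u ++ false ∷ v) (reversal-word q) (reversal-word r))
reversal-rightWord q (frame _ _ r ∷ z) e = trans (reversal-∷-++ (rightWord r z e) true (word q))
  (cong₂ (λ u v → u ++ false ∷ v) (reversal-word q) (reversal-rightWord r z e))

-- The leading 0 of `F` turns into the asterisk closing the first node of the new path, and the
-- trees `q` follow it.
reversal-leftWord : ∀ q z e →
  complementedReversal (leftWord z e) ++ word q ≡ rightWord q (map reflect z) (reflect e)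
reversal-leftWord q [] (frame l _ _) = trans (cong (_++ word q) (trans (reversal-∷ false (word l)) (cong (_++ [ true ]) (reversal-word l))))
  (++-assoc (word (mirror l)) [ true ] _)
reversal-leftWord q (frame l _ _ ∷ z) e = begin
  complementedReversal (false ∷ word l ++ leftWord z e) ++ word q
    ≡⟨ cong (_++ word q) (trans (reversal-∷ false (word l ++ leftWord z e)) (cong (_++ [ true ]) (trans (reversal-++ (word l) _)
         (trans (cong (complementedReversal (leftWord z e) ++_) (reversal-word l)) (reversal-leftWord (mirror l) z e))))) ⟩
  (rightWord (mirror l) (map reflect z) (reflect e) ++ [ true ]) ++ word q
    ≡⟨ ++-assoc _ [ true ] _ ⟩
  rightWord (mirror l) (map reflect z) (reflect e) ++ true ∷ word q ∎
  where open ≡-Reasoning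

-- After the reversal `mirror q` comes first; moving its word to the end brings the former closing
-- asterisk of the root to the front as the leading 0.
rotate-turn : ∀ q z e → let Z = zipper q z e in Marks (label Z) (mirror q) (map reflect z) (reflect e) →
  CyclicTranslate (complementedReversal (leftWord z e ++ true ∷ rightWord q z e)) (false ∷ word (plug (turn Z)))
rotate-turn q z e m = subst₂ CyclicTranslate reversed turned
  (rotate (left ++ false ∷ complementedReversal (leftWord z e)) (word (mirror q))
    (≤-trans (s≤s z≤n) (≤-reflexive (cong length (sym turned)))))
  where
  left = leftWord (map reflect z) (reflect e)
  reversed : word (mirror q) ++ left ++ false ∷ complementedReversal (leftWord z e) ≡
    complementedReversal (leftWord z e ++ true ∷ rightWord q z e)
  reversed = sym (trans (reversal-∷-++ (leftWord z e) true (rightWord q z e))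
    (trans (cong (_++ false ∷ complementedReversal (leftWord z e)) (reversal-rightWord q z e)) (++-assoc (word (mirror q)) left _)))
  turned : (left ++ false ∷ complementedReversal (leftWord z e)) ++ word (mirror q) ≡
    false ∷ word (plug (turn (zipper q z e)))
  turned = trans (++-assoc left _ _) (trans (cong (λ u → left ++ false ∷ u) (reversal-leftWord (mirror q) z e))
    (trans (sym (map-enc-close bit (Frame.label e) refl (λ _ → refl) (mirror q) (map reflect z) (reflect e) m))
      (cong (false ∷_) (map-bit-enc (plug (turn (zipper q z e)))))))

setBitAt-≢ : ∀ {p x} → x ≢ p → setBitAt p (number x) ≡ false
setBitAt-≢ {p} {x} x≢p = dec-false (number x ≟ᴱ number p) (x≢p ∘ Maybe.just-injective)

-- The path behind a colour change. Unlike the bare value of `neighbour`, it can be turned back and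
-- extended by a sprout.
record Edge (n p : ℕ) (α γ : Germ (suc n)) : Set where
  field
    location : Zipper
    colour   : label location ≡ p
    source   : plug location ≡ forest (suc n) α
    target   : plug (turn location) ≅ forest (suc n) γ

edge-neighbour : ∀ {n p α γ} → Edge n p α γ → neighbour (suc n) p α ≡ γ
edge-neighbour {n} {p} {α} {γ} edge with Edge.location edge in eq | Edge.colour edge | Edge.source edge | Edge.target edge
... | Z@(zipper q z e) | refl | src | tgt = neighbour-unique n p α γ
  (subst₂ CyclicTranslate (cong complementedReversal (sym flipped))
    (cong (false ∷_) (≅⇒word (plug (turn Z)) (forest (suc n) γ) tgt)) (rotate-turn q z e (marks _ _ (reflect e) turned-distinct)))
  where
  lab = forest-labelled n α
  turned-distinct : occurrences p (plug (turn Z)) ≤ 1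
  turned-distinct = ≤-trans (≤-reflexive (trans (weight-turn (δ p) Z) (cong (occurrences p) src))) (lab .distinct p)
  marked : Marks p q z e
  marked = marks q z e (≤-trans (≤-reflexive (cong (occurrences p) src)) (lab .distinct p))
  -- The colour 0 belongs to the leading entry of `F` and to no node.
  p≢0 : 0 ≢ p
  p≢0 refl = contradiction (≤-trans (occurs-close q z e) (≤-reflexive (trans (cong (occurrences p) src) (lab .fresh z≤n)))) λ ()
  flipped : θ-flipped (suc n) p α ≡ leftWord z e ++ true ∷ rightWord q z e
  flipped = begin
    map (setBitAt p) (F (suc n) α)
      ≡⟨ cong (map (setBitAt p)) (F-forest n α) ⟩
    setBitAt p (number 0) ∷ map (setBitAt p) (enc (forest (suc n) α))
      ≡⟨ cong₂ (λ b f → b ∷ map (setBitAt p) (enc f)) (setBitAt-≢ p≢0) (sym src) ⟩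
    false ∷ map (setBitAt p) (enc (close q z e))
      ≡⟨ map-enc-close (setBitAt p) p refl setBitAt-≢ q z e marked ⟩
    leftWord z e ++ setBitAt p (number p) ∷ rightWord q z e
      ≡⟨ cong (λ b → leftWord z e ++ b ∷ rightWord q z e) (dec-true (number p ≟ᴱ number p) refl) ⟩
    leftWord z e ++ true ∷ rightWord q z e ∎
    where open ≡-Reasoning

-- Colour 0 flips the leading entry and leaves the word of the forest intact, so there is no path
-- and the reversal mirrors the whole forest.
mirror-neighbour : ∀ n α γ → mirror (forest (suc n) α) ≅ forest (suc n) γ → neighbour (suc n) 0 α ≡ γ
mirror-neighbour n α γ eq = neighbour-unique n 0 α γ
  (subst₂ CyclicTranslate (sym reversed) (cong (false ∷_) (≅⇒word (mirror f) (forest (suc n) γ) eq))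
    (rotate [ false ] (word (mirror f)) (s≤s z≤n)))
  where
  f = forest (suc n) α
  reversed : complementedReversal (θ-flipped (suc n) 0 α) ≡ word (mirror f) ++ [ false ]
  reversed = trans (cong (complementedReversal ∘ map (setBitAt 0)) (F-forest n α))
    (trans (cong (λ u → complementedReversal (true ∷ u)) (map-enc (setBitAt 0) 0 refl setBitAt-≢ f (forest-labelled n α .fresh z≤n)))
      (trans (reversal-∷ true (word f)) (cong (_++ [ false ]) (reversal-word f))))

edge-from : ∀ {n p} α → 1 ≤ p → p ≤ suc n → ∃[ γ ] Edge n p α γ
edge-from {n} {p} α 1≤p p≤ with locate p (forest (suc n) α) (occurs-forest n α p 1≤p p≤)
... | Z , src , col with forest-surjective n (plug (turn Z))
        (trans (weight-turn (const 1) Z) (trans (cong size src) (size-forest n α)))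
...   | γ , tgt = γ , record { location = Z ; colour = col ; source = src ; target = sym tgt }

label-reached : ∀ {n} {α : Germ (suc n)} i Z → plug Z ≡ forest (suc n) α → Reached i Z → label Z ≡ suc i
label-reached {n} {α} i Z@(zipper _ _ (frame _ _ _)) src r = forest-label n α i (trans (cong (pops i) (sym src)) r)

edge-reached : ∀ {n p α γ} (edge : Edge n p α γ) → ∃[ i ] p ≡ suc i × Reached i (Edge.location edge)
edge-reached {α = α} edge with reached (Edge.location edge)
... | i , r = i , trans (sym (Edge.colour edge)) (label-reached {α = α} i (Edge.location edge) (Edge.source edge) r) , r

-- The turned path is lifted to the forest of `γ`. Its label there is again `p`: the sizes fix its
-- position, and in the forest of a germ labels are positions. A second turn then restores the shape
-- of the source.
edge-sym : ∀ {n p α γ} → Edge n p α γ → Edge n p γ α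
edge-sym {n} {p} {α} {γ} edge with lift (forest (suc n) γ) _ _ _ (trans (sym (Edge.target edge)) (strip-plug (turn (Edge.location edge))))
... | Z , src , strips with edge-reached edge
...   | i , p≡ , r = record
  { location = Z
  ; colour   = trans (label-reached {α = γ} i Z (sym src) (size-reached i Z sizes)) (sym p≡)
  ; source   = sym src
  ; target   = begin
      strip (plug (turn Z))                 ≡⟨ trans (strip-plug (turn Z)) (cong plug (strip-turn Z)) ⟩
      plug (turn (stripZipper Z))           ≡⟨ cong (plug ∘ turn) (trans strips (strip-turn Y)) ⟩
      plug (turn (turn (stripZipper Y)))    ≡⟨ cong plug (turn-involutive (stripZipper Y)) ⟩
      plug (stripZipper Y)                  ≡⟨ sym (strip-plug Y) ⟩
      strip (plug Y)                        ≡⟨ cong strip (Edge.source edge) ⟩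
      strip (forest (suc n) α)              ∎
  }
  where
  open ≡-Reasoning
  Y = Edge.location edge
  queues : queue Z ≅ queue (turn Y)
  queues = trans (strip-queue Z) (trans (cong queue strips) (sym (strip-queue (turn Y))))
  sizes : suc i + size (queue Z) ≡ size (plug Z)
  sizes = trans (cong (suc i +_) (≅-size (queue Z) (queue (turn Y)) queues))
    (trans (reached-size i (turn Y) (reached-turn i Y r))
      (trans (≅-size (plug (turn Y)) (forest (suc n) γ) (Edge.target edge)) (cong size src)))

edge-pops : ∀ {n p α γ} → Edge n p α γ → pops p (forest (suc n) γ) ≅ mirror (pops p (forest (suc n) α))
edge-pops {n} {p} {α} {γ} edge with edge-reached edge
... | i , refl , r = begin
  strip (pops p (forest (suc n) γ))       ≡⟨ ≅-pops p (forest (suc n) γ) (plug (turn Z)) (sym (Edge.target edge)) ⟩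
  strip (pops p (plug (turn Z)))          ≡⟨ cong strip (reached-queue i (turn Z) (reached-turn i Z r)) ⟩
  strip (queue (turn Z))                  ≡⟨ cong strip (queue-turn Z) ⟩
  strip (mirror (queue Z))                ≡⟨ cong (strip ∘ mirror) (trans (sym (reached-queue i Z r)) (cong (pops p) (Edge.source edge))) ⟩
  strip (mirror (pops p (forest (suc n) α))) ∎
  where
  open ≡-Reasoning
  Z = Edge.location edge

edge : ∀ n p → 1 ≤ p → p ≤ suc n → ∀ α → Edge n p α (neighbour (suc n) p α)
edge n p 1≤p p≤ α with edge-from α 1≤p p≤
... | γ , e = subst (Edge n p α) (sym (edge-neighbour e)) e

neighbour-involutive : ∀ n p → 1 ≤ p → p ≤ suc n → ∀ α → neighbour (suc n) p (neighbour (suc n) p α) ≡ α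
neighbour-involutive n p 1≤p p≤ α = edge-neighbour (edge-sym (edge n p 1≤p p≤ α))

-- At `p = 0` nothing is popped and the queue is the whole forest, so colour 0 follows the same
-- pattern.
pops-neighbour : ∀ n p → p ≤ suc n → ∀ α →
  pops p (forest (suc n) (neighbour (suc n) p α)) ≅ mirror (pops p (forest (suc n) α))
pops-neighbour n (suc p) p≤ α = edge-pops (edge n (suc p) (s≤s z≤n) p≤ α)
pops-neighbour n zero    _  α with forest-surjective n (mirror (forest (suc n) α)) (trans (weight-mirror _ (forest (suc n) α)) (size-forest n α))
... | γ , eq rewrite mirror-neighbour n α γ (sym eq) = eq

entry-neighbour : ∀ n p → p < n → ∀ (α : Germ (suc n)) →
  entry (string (neighbour (suc n) p α)) (suc p) ≡ entry (string α) (suc p)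
entry-neighbour n p p<n α = suc-injective (begin
  suc (entry (string γ) (suc p))           ≡⟨ sym (length-pops leaf (string γ) (restricted γ) p p<n) ⟩
  length (pops p (forest (suc n) γ))       ≡⟨ ≅-length (pops p (forest (suc n) γ)) (mirror (pops p (forest (suc n) α))) (pops-neighbour n p (≤-trans (<⇒≤ p<n) (n≤1+n n)) α) ⟩
  length (mirror (pops p (forest (suc n) α))) ≡⟨ length-mirror (pops p (forest (suc n) α)) ⟩
  length (pops p (forest (suc n) α))       ≡⟨ length-pops leaf (string α) (restricted α) p p<n ⟩
  suc (entry (string α) (suc p))           ∎)
  where
  open ≡-Reasoning
  γ = neighbour (suc n) p α
  leaf = [ node (suc n) [] ]

-- Prefixing a zero

-- sprout k attaches a leaf labelled k + 1 to the leaf labelled k.  This is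
-- the effect on forests of prefixing a zero to a k-germ.
feed : ℕ → ℕ → Forest → Forest → Forest
feed k x (_ ∷ _) s = s
feed k x []      s with x ≟ k
... | yes _ = [ node (suc k) [] ]
... | no  _ = []

sprout : ℕ → Forest → Forest
sprout k []               = []
sprout k (node x cs ∷ ts) = node x (feed k x cs (sprout k cs)) ∷ sprout k ts

feed-≡ : ∀ k s → feed k k [] s ≡ [ node (suc k) [] ]
feed-≡ k s with k ≟ k
... | yes _   = refl
... | no  k≢k = contradiction refl k≢k

feed-≢ : ∀ k x cs → x ≢ k → feed k x cs (sprout k cs) ≡ sprout k cs
feed-≢ k x (_ ∷ _) _   = refl
feed-≢ k x []      x≢k with x ≟ k
... | yes x≡k = contradiction x≡k x≢k
... | no  _   = refl

feed-++-∷ : ∀ k x u t v s → feed k x (u ++ t ∷ v) s ≡ s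
feed-++-∷ k x []      t v s = refl
feed-++-∷ k x (_ ∷ _) t v s = refl

feed-close : ∀ k x q z e s → feed k x (close q z e) s ≡ s
feed-close k x q []                (frame _ _ _) s = feed-++-∷ k x q _ _ s
feed-close k x q (frame _ _ _ ∷ z) e             s = feed-++-∷ k x q _ _ s

sprout-++ : ∀ k f g → sprout k (f ++ g) ≡ sprout k f ++ sprout k g
sprout-++ k []               g = refl
sprout-++ k (node x cs ∷ ts) g = cong (node x (feed k x cs (sprout k cs)) ∷_) (sprout-++ k ts g)

length-sprout : ∀ k f → length (sprout k f) ≡ length f
length-sprout k []               = refl
length-sprout k (node x cs ∷ ts) = cong suc (length-sprout k ts)

sprout-take : ∀ k a f → sprout k (take a f) ≡ take a (sprout k f)
sprout-take k zero    f                = refl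
sprout-take k (suc a) []               = refl
sprout-take k (suc a) (node _ cs ∷ ts) = cong (_ ∷_) (sprout-take k a ts)

sprout-drop : ∀ k a f → sprout k (drop a f) ≡ drop a (sprout k f)
sprout-drop k zero    f                = refl
sprout-drop k (suc a) []               = refl
sprout-drop k (suc a) (node _ cs ∷ ts) = sprout-drop k a ts

sprout-mirror : ∀ k f → sprout k (mirror f) ≡ mirror (sprout k f)
sprout-mirror k []               = refl
sprout-mirror k (node x cs ∷ ts) = trans (sprout-++ k (mirror ts) _)
  (cong₂ (λ u v → u ++ [ node x v ]) (sprout-mirror k ts) (feed-mirror cs))
  where
  feed-mirror : ∀ cs → feed k x (mirror cs) (sprout k (mirror cs)) ≡ mirror (feed k x cs (sprout k cs))
  feed-mirror [] with x ≟ k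
  ... | yes _ = refl
  ... | no  _ = refl
  feed-mirror (node y ds ∷ cs) = trans (feed-++-∷ k x (mirror cs) _ [] _) (sprout-mirror k (node y ds ∷ cs))

sprout-absent : ∀ k f → occurrences k f ≡ 0 → sprout k f ≡ f
sprout-absent k []               _  = refl
sprout-absent k (node x cs ∷ ts) o0 = cong₂ (λ u v → node x u ∷ v)
  (trans (feed-≢ k x cs (δ≡0 (m+n≡0⇒m≡0 _ d+cs))) (sprout-absent k cs (m+n≡0⇒n≡0 (δ k x) d+cs)))
  (sprout-absent k ts (m+n≡0⇒n≡0 (δ k x + occurrences k cs) o0))
  where d+cs = m+n≡0⇒m≡0 (δ k x + occurrences k cs) o0

sprout-grow : ∀ {k x} a f → x ≢ k → sprout k (grow x a f) ≡ grow x a (sprout k f)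
sprout-grow {k} {x} a f x≢k = cong₂ (λ u v → node x u ∷ v)
  (trans (feed-≢ k x (drop a f) x≢k) (sprout-drop k a f)) (sprout-take k a f)

sprout-forestFrom : ∀ {n k} f (as : Vec ℕ n) → n < k → sprout k (forestFrom f as) ≡ forestFrom (sprout k f) as
sprout-forestFrom             f []       _   = refl
sprout-forestFrom {suc n} {k} f (a ∷ as) n<k = trans (sprout-forestFrom (grow (suc n) a f) as (<⇒≤ n<k))
  (cong (λ g → forestFrom g as) (sprout-grow a f (<⇒≢ n<k)))

sprout-leaf : ∀ k → sprout k [ node k [] ] ≡ [ node k [ node (suc k) [] ] ]
sprout-leaf k = cong (λ cs → [ node k cs ]) (feed-≡ k [])

-- The leading zero first puts the node k over the initial leaf k + 1, and this is the initial leaf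
-- k sprouted.
sprout-forest : ∀ n (α : Germ (suc n)) → sprout (suc n) (forest (suc n) α) ≡ forest (suc (suc n)) (prefix Fin.zero α)
sprout-forest n α = trans (sprout-forestFrom _ (string α) ≤-refl) (cong (λ f → forestFrom f (string α)) (sprout-leaf (suc n)))

sproutFrame : ℕ → Frame → Frame
sproutFrame k (frame l x r) = frame (sprout k l) x (sprout k r)

sproutZipper : ℕ → Zipper → Zipper
sproutZipper k (zipper q z e) = zipper (sprout k q) (map (sproutFrame k) z) (sproutFrame k e)

sprout-close : ∀ k q z e → Frame.label e ≢ k →
  sprout k (close q z e) ≡ close (sprout k q) (map (sproutFrame k) z) (sproutFrame k e)
sprout-close k q [] (frame l x r) x≢k = trans (sprout-++ k q _)
  (cong (λ cs → sprout k q ++ node x cs ∷ sprout k l) (feed-≢ k x r x≢k))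
sprout-close k q (frame l x r ∷ z) e x≢k = trans (sprout-++ k q _)
  (cong (λ cs → sprout k q ++ node x cs ∷ sprout k l) (trans (feed-close k x r z e _) (sprout-close k r z e x≢k)))

sprout-plug : ∀ k Z → label Z ≢ k → sprout k (plug Z) ≡ plug (sproutZipper k Z)
sprout-plug k (zipper q z e) = sprout-close k q z e

sprout-reflect : ∀ k e → sproutFrame k (reflect e) ≡ reflect (sproutFrame k e)
sprout-reflect k (frame l x r) = cong₂ (λ u v → frame u x v) (sprout-mirror k r) (sprout-mirror k l)

sprout-turn : ∀ k Z → sproutZipper k (turn Z) ≡ turn (sproutZipper k Z)
sprout-turn k (zipper q z e) rewrite sprout-mirror k q | sprout-reflect k e =
  cong (λ z → zipper (mirror (sprout k q)) z (reflect (sproutFrame k e)))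
    (trans (sym (map-∘ z)) (trans (map-cong (sprout-reflect k) z) (map-∘ z)))

-- The labels of `f` decide where `sprout` acts, its shape decides the entries, and after an
-- exchange the two no longer match. While no popped node is labelled `k`, sprouting commutes with
-- popping, so a comparison after `n` pops suffices.
sprout-≅ : ∀ {n} k f g g′ (as : Vec ℕ n) → Restricted (length g) as →
  (∀ i → i < n → ∀ {x cs ts} → pops i f ≡ node x cs ∷ ts → x ≢ k) →
  forestFrom g as ≅ f → g′ ≅ sprout k (pops n f) → forestFrom g′ as ≅ sprout k f
sprout-≅ k f g g′ [] _ _ _ eq = eq
sprout-≅ {suc m} k f g g′ (a ∷ as) (a≤ ∷ r) heads eq eq′ with pops m f in popped
  | subst (_≅ pops m f) (pops-forestFrom (grow (suc m) a g) as) (≅-pops m (forestFrom (grow (suc m) a g) as) f eq)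
... | []             | ()
... | node x cs ∷ ts | grown = sprout-≅ k f (grow (suc m) a g) (grow (suc m) a g′) as
  (restricted-grow {x = suc m} {g} a≤ r) (λ i i<m → heads i (m≤n⇒m≤1+n i<m)) eq (begin
    strip (grow (suc m) a g′)
      ≡⟨ ≅-grow (suc m) x a g′ (sprout k ts ++ sprout k cs) (trans eq′ (cong strip (trans (cong (sprout k) next) (sprout-++ k ts cs)))) ⟩
    strip (node x (drop a (sprout k ts ++ sprout k cs)) ∷ take a (sprout k ts ++ sprout k cs))
      ≡⟨ cong (λ a → strip (node x (drop a (sprout k ts ++ sprout k cs)) ∷ take a (sprout k ts ++ sprout k cs))) width ⟩
    strip (node x (drop (length (sprout k ts)) (sprout k ts ++ sprout k cs)) ∷ take (length (sprout k ts)) (sprout k ts ++ sprout k cs))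
      ≡⟨ cong₂ (λ u v → strip (node x u ∷ v)) (drop-length (sprout k ts) _) (take-length (sprout k ts) _) ⟩
    strip (node x (sprout k cs) ∷ sprout k ts)
      ≡⟨ cong (λ u → strip (node x u ∷ sprout k ts)) (sym (feed-≢ k x cs (heads m ≤-refl popped))) ⟩
    strip (sprout k (node x cs ∷ ts))
      ≡⟨ cong (strip ∘ sprout k) (sym popped) ⟩
    strip (sprout k (pops m f)) ∎)
  where
  open ≡-Reasoning
  next : pops (suc m) f ≡ ts ++ cs
  next = trans (pops-suc m f) (cong pop popped)
  width : a ≡ length (sprout k ts)
  width = trans (suc-injective (trans (sym (length-grow (suc m) g a≤)) (≅-length (grow (suc m) a g) (node x cs ∷ ts) grown)))
    (sym (length-sprout k ts))

-- Popping a node labelled `k` would remove the only one, yet one is left after `n` pops.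
heads-≢ : ∀ k n f → occurrences k f ≤ 1 → 1 ≤ occurrences k (pops n f) →
  ∀ i → i < n → ∀ {x cs ts} → pops i f ≡ node x cs ∷ ts → x ≢ k
heads-≢ k n f ≤1 1≤ i i<n {cs = cs} {ts} popped refl = contradiction (begin
  2                                                  ≤⟨ s≤s 1≤ ⟩
  suc (occurrences k (pops n f))                     ≡⟨ cong (suc ∘ occurrences k) (trans (cong (λ m → pops m f) (sym (m+[n∸m]≡n i<n))) (pops-+ (suc i) (n ∸ suc i) f)) ⟩
  suc (occurrences k (pops (n ∸ suc i) (pops (suc i) f))) ≤⟨ s≤s (weight-pops-≤ (δ k) (n ∸ suc i) _) ⟩
  suc (occurrences k (pops (suc i) f))               ≡⟨ cong (suc ∘ occurrences k) (trans (pops-suc i f) (cong pop popped)) ⟩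
  suc (occurrences k (ts ++ cs))                     ≡⟨ cong (_+ occurrences k (ts ++ cs)) (sym (δ-refl k)) ⟩
  δ k k + occurrences k (ts ++ cs)                   ≡⟨ weight-pop (δ k) k cs ts ⟩
  occurrences k (node k cs ∷ ts)                     ≡⟨ cong (occurrences k) (sym popped) ⟩
  occurrences k (pops i f)                           ≤⟨ weight-pops-≤ (δ k) i f ⟩
  occurrences k f                                    ≤⟨ ≤1 ⟩
  1                                                  ∎) λ { (s≤s ()) }
  where open ≤-Reasoning

-- The condition on `pops n f` puts the label k on the last node in breadth-first order, which is
-- where a leading zero attaches its leaf.
prefix-≅ : ∀ n f (α : Germ (suc n)) → f ≅ forest (suc n) α → occurrences (suc n) f ≤ 1 →
  pops n f ≡ [ node (suc n) [] ] → sprout (suc n) f ≅ forest (suc (suc n)) (prefix Fin.zero α)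
prefix-≅ n f α eq ≤1 popped = sym (sprout-≅ (suc n) f [ node (suc n) [] ] [ node (suc n) [ node (suc (suc n)) [] ] ]
  (string α) (restricted α)
  (heads-≢ (suc n) n f ≤1 (≤-trans (occurrences-root (suc n) [] []) (≤-reflexive (cong (occurrences (suc n)) (sym popped)))))
  (sym eq) (cong strip (sym (trans (cong (sprout (suc n)) popped) (sprout-leaf (suc n))))))

edge-distinct : ∀ {n p α γ} (e : Edge n p α γ) → Distinct (plug (turn (Edge.location e)))
edge-distinct {n} {α = α} e p = ≤-trans
  (≤-reflexive (trans (weight-turn (δ p) (Edge.location e)) (cong (occurrences p) (Edge.source e)))) (forest-labelled n α .distinct p)

-- After k - 1 pops only the leaf k is in the queue. Since `queue-turn` holds with labels, the last
-- node of the turned forest is still labelled k.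
edge-prefix-second : ∀ {n α γ} → Edge n n α γ → Edge (suc n) n (prefix Fin.zero α) (prefix Fin.zero γ)
edge-prefix-second {n} {α} {γ} e with edge-reached e
... | i , refl , r = record
  { location = sproutZipper (suc n) Z
  ; colour   = Edge.colour e
  ; source   = trans (sym (sprout-plug (suc n) Z (label≢ (Edge.colour e)))) (trans (cong (sprout (suc n)) (Edge.source e)) (sprout-forest n α))
  ; target   = trans (cong strip (trans (cong plug (sym (sprout-turn (suc n) Z))) (sym (sprout-plug (suc n) (turn Z) (label≢ (Edge.colour e))))))
                 (prefix-≅ n (plug (turn Z)) γ (Edge.target e) (edge-distinct e (suc n)) popped)
  }
  where
  Z = Edge.location e
  label≢ : ∀ {x} → x ≡ n → x ≢ suc n
  label≢ refl = <⇒≢ ≤-refl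
  popped : pops n (plug (turn Z)) ≡ [ node (suc n) [] ]
  popped = begin
    pops n (plug (turn Z))          ≡⟨ reached-queue i (turn Z) (reached-turn i Z r) ⟩
    queue (turn Z)                  ≡⟨ queue-turn Z ⟩
    mirror (queue Z)                ≡⟨ cong mirror (sym (reached-queue i Z r)) ⟩
    mirror (pops n (plug Z))        ≡⟨ cong (mirror ∘ pops n) (Edge.source e) ⟩
    mirror (pops n (forest (suc n) α)) ≡⟨ cong mirror (pops-forestFrom _ (string α)) ⟩
    [ node (suc n) [] ]             ∎
    where open ≡-Reasoning

-- The trees beside the path lack the label `k`, so the sprout only lengthens the path by one frame.
sprout-extend : ∀ k q z → Marks k q z (frame [] k []) →
  sprout k (close q z (frame [] k [])) ≡ close q (z ++ [ frame [] k [] ]) (frame [] (suc k) [])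
sprout-extend k q [] (here q0 _ _) = trans (sprout-++ k q _) (cong₂ _++_ (sprout-absent k q q0) (sprout-leaf k))
sprout-extend k q (frame l x r ∷ z) (there q0 _ l0 m) = trans (sprout-++ k q _) (cong₂ _++_ (sprout-absent k q q0)
  (cong₂ (λ u v → node x u ∷ v) (trans (feed-close k x r z _ _) (sprout-extend k r z m)) (sprout-absent k l l0)))

node-injective : ∀ {x y cs ds} → node x cs ≡ node y ds → cs ≡ ds
node-injective refl = refl

-- The last node k has no children and nothing waits behind it, so the frame added by the sprout is
-- empty and reflection leaves it unchanged.
edge-prefix-first : ∀ {n α γ} → Edge n (suc n) α γ → Edge (suc n) (suc (suc n)) (prefix Fin.zero α) (prefix Fin.zero γ)
edge-prefix-first {n} {α} {γ} record { location = Z@(zipper q z (frame l _ r)) ; colour = refl ; source = src ; target = tgt }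
  = extend (++-conicalˡ l _ (∷-injectiveʳ last)) (node-injective (∷-injectiveˡ last))
  where
  e : Edge n (suc n) α γ
  e = record { location = Z ; colour = refl ; source = src ; target = tgt }
  rch : Reached n Z
  rch with edge-reached e
  ... | _ , refl , rch = rch
  last : node (suc n) r ∷ waiting Z ≡ [ node (suc n) [] ]
  last = trans (sym rch) (trans (cong (pops n) src) (pops-forestFrom _ (string α)))
  last-turn : waiting (turn Z) ≡ []
  last-turn = ++-conicalˡ (waiting (turn Z)) _ (trans (queue-turn Z)
    (cong mirror (cong₂ _++_ (∷-injectiveʳ last) (node-injective (∷-injectiveˡ last)))))
  extend : l ≡ [] → r ≡ [] → Edge (suc n) (suc (suc n)) (prefix Fin.zero α) (prefix Fin.zero γ)
  extend refl refl = record
    { location = zipper q (z ++ [ frame [] (suc n) [] ]) (frame [] (suc (suc n)) [])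
    ; colour   = refl
    ; source   = trans (sym (sprout-extend (suc n) q z (marks q z _ (≤-trans (≤-reflexive (cong (occurrences (suc n)) src)) (forest-labelled n α .distinct (suc n))))))
                   (trans (cong (sprout (suc n)) src) (sprout-forest n α))
    ; target   = trans (cong strip (trans (cong (λ z → close (mirror q) z (frame [] (suc (suc n)) [])) (map-++ reflect z _))
                     (sym (sprout-extend (suc n) (mirror q) (map reflect z) (marks (mirror q) (map reflect z) _ (edge-distinct e (suc n)))))))
                   (prefix-≅ n (plug (turn Z)) γ tgt (edge-distinct e (suc n))
                     (trans (reached-turn n Z rch) (cong (node (suc n) [] ∷_) last-turn)))
    }

-- If the label k - 1 has k as its only child, then after the colour change
-- it is a leaf with k waiting next to it.
second-colour-entry : ∀ {n α γ} → Edge (suc n) (suc n) (prefix Fin.zero α) γ → entry (string γ) (suc n) ≡ 1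
second-colour-entry {n} {α} {γ} e@record { location = Z@(zipper q z (frame l x r)) ; target = tgt } with edge-reached e
... | _ , refl , rch = suc-injective (begin
  suc (entry (string γ) (suc n))
    ≡⟨ sym (length-pops _ (string γ) (restricted γ) n ≤-refl) ⟩
  length (pops n (forest (suc (suc n)) γ))
    ≡⟨ sym (≅-length (pops n (plug (turn Z))) _ (≅-pops n (plug (turn Z)) _ tgt)) ⟩
  length (pops n (plug (turn Z)))
    ≡⟨ cong length (reached-turn n Z rch) ⟩
  suc (length (waiting (turn Z)))
    ≡⟨ cong (suc ∘ length) (sym (trans (cong (λ l → waiting (turn Z) ++ mirror l) (++-conicalˡ l _ (∷-injectiveʳ last))) (++-identityʳ _))) ⟩
  suc (length (queue (turn Z)))
    ≡⟨ cong (suc ∘ length) (queue-turn Z) ⟩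
  suc (length (mirror (waiting Z ++ r)))
    ≡⟨ cong (λ f → suc (length (mirror f))) (cong₂ _++_ (∷-injectiveʳ last) (node-injective (∷-injectiveˡ last))) ⟩
  2 ∎)
  where
  open ≡-Reasoning
  last : node x r ∷ waiting Z ≡ [ node (suc n) [ node (suc (suc n)) [] ] ]
  last = trans (sym rch) (trans (cong (pops n) (Edge.source e)) (pops-forestFrom _ (string α)))

-- The natural enumeration

<ₗₑₓ-irrefl : ∀ {b n} {α β : RestrictedString b n} → α ≡ β → ¬ (α <ₗₑₓ β)
<ₗₑₓ-irrefl refl = Lex.<-irrefl <-irrefl (Pointwise.refl refl)

lookup-unique : ∀ {b n} (xs : List (RestrictedString b n)) → AllPairs _<ₗₑₓ_ xs →
  ∀ i j → lookup xs i ≡ lookup xs j → i ≡ j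
lookup-unique (x ∷ xs) (px ∷ pxs) Fin.zero    Fin.zero    eq = refl
lookup-unique (x ∷ xs) (px ∷ pxs) Fin.zero    (Fin.suc j) eq = contradiction (All.lookup px (∈-lookup j)) (<ₗₑₓ-irrefl eq)
lookup-unique (x ∷ xs) (px ∷ pxs) (Fin.suc i) Fin.zero    eq = contradiction (All.lookup px (∈-lookup i)) (<ₗₑₓ-irrefl (sym eq))
lookup-unique (x ∷ xs) (px ∷ pxs) (Fin.suc i) (Fin.suc j) eq = cong Fin.suc (lookup-unique xs pxs i j eq)

germAt-indexOf : ∀ k α → germAt k (indexOf k α) ≡ α
germAt-indexOf k α = trans (cong (lookup (germs k)) (Fin.cast-involutive (sym (length-germs k)) (length-germs k) _))
  (sym (lookup-index (germs-complete k α)))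

indexOf-germAt : ∀ k m → indexOf k (germAt k m) ≡ m
indexOf-germAt k m = trans
  (cong (cast (length-germs k)) (lookup-unique (germs k) (germs-sorted k) _ _ (sym (lookup-index (germs-complete k (germAt k m))))))
  (Fin.cast-involutive (length-germs k) (sym (length-germs k)) m)

lookup-map-++ : ∀ {A B : Set} (f : A → B) xs ys i j → toℕ i ≡ toℕ j → lookup (map f xs ++ ys) i ≡ f (lookup xs j)
lookup-map-++ f (x ∷ xs) ys Fin.zero    Fin.zero    _  = refl
lookup-map-++ f (x ∷ xs) ys (Fin.suc i) (Fin.suc j) eq = lookup-map-++ f xs ys i j (suc-injective eq)

-- The list of germs begins with those having a leading zero, in the order of the shorter germs.
germAt-prefix : ∀ n m m′ → toℕ m′ ≡ toℕ m → germAt (suc (suc n)) m′ ≡ prefix Fin.zero (germAt (suc n) m)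
germAt-prefix n m m′ eq = lookup-map-++ (prefix Fin.zero) (germs (suc n)) _ _ _
  (trans (Fin.toℕ-cast _ m′) (trans eq (sym (Fin.toℕ-cast _ m))))

indexOf-prefix : ∀ n α → toℕ (indexOf (suc (suc n)) (prefix Fin.zero α)) ≡ toℕ (indexOf (suc n) α)
indexOf-prefix n α = begin
  toℕ (indexOf (suc (suc n)) (prefix Fin.zero α))
    ≡⟨ cong (toℕ ∘ indexOf (suc (suc n))) (sym (trans (germAt-prefix n m m′ (Fin.toℕ-inject≤ m _)) (cong (prefix Fin.zero) (germAt-indexOf (suc n) α)))) ⟩
  toℕ (indexOf (suc (suc n)) (germAt (suc (suc n)) m′))
    ≡⟨ trans (cong toℕ (indexOf-germAt (suc (suc n)) m′)) (Fin.toℕ-inject≤ m _) ⟩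
  toℕ m ∎
  where
  open ≡-Reasoning
  m = indexOf (suc n) α
  m′ = inject≤ m (catalan-mono (suc n))

entry-head : ∀ {n} a (as : Vec ℕ n) → entry (a ∷ as) (suc n) ≡ a
entry-head {n} a as with suc n ≟ suc n
... | yes _   = refl
... | no  n≢n = contradiction refl n≢n

head-zero : ∀ n (α : Germ (suc (suc n))) → entry (string α) (suc n) ≡ 0 → ∃[ γ ] α ≡ prefix Fin.zero γ
head-zero n ((a ∷ as) , (a≤ ∷ r)) eq with trans (sym (entry-head a as)) eq
... | refl = (as , r) , germ-≡ _ _ refl

head-cases : ∀ n (α : Germ (suc (suc n))) → (∃[ γ ] α ≡ prefix Fin.zero γ) ⊎ entry (string α) (suc n) ≡ 1
head-cases n α@((zero ∷ as) , _)              = inj₁ (head-zero n α (entry-head 0 as))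
head-cases n ((suc zero ∷ as) , _)            = inj₂ (entry-head 1 as)
head-cases n ((suc (suc _) ∷ as) , (s≤s () ∷ _))

-- All rows below this bound are taken by germs with a leading zero.
index-head : ∀ n (α : Germ (suc (suc n))) → entry (string α) (suc n) ≡ 1 → catalan (suc n) ≤ toℕ (indexOf (suc (suc n)) α)
index-head n α eq = ≮⇒≥ λ m< → contradiction
  (trans (sym eq) (trans (cong (λ β → entry (string β) (suc n)) (trans (sym (germAt-indexOf (suc (suc n)) α))
    (germAt-prefix n (fromℕ< m<) (indexOf (suc (suc n)) α) (sym (Fin.toℕ-fromℕ< m<)))))
    (entry-head 0 (string (germAt (suc n) (fromℕ< m<)))))) λ ()

catalan-strict : ∀ n → catalan (suc n) < catalan (suc (suc n))
catalan-strict n = ≤-<-trans (index-head n β (entry-head 1 (string (zeros 2 n)))) (Fin.toℕ<n (indexOf (suc (suc n)) β))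
  where
  β : Germ (suc (suc n))
  β = prefix (Fin.suc Fin.zero) (zeros 2 n)

n<catalan : ∀ n → n < catalan (suc n)
n<catalan zero    = ≤-refl
n<catalan (suc n) = ≤-<-trans (n<catalan n) (catalan-strict n)

catalan-≤ : ∀ {m n} → m ≤ n → catalan m ≤ catalan n
catalan-≤ {m} {n} m≤n = subst (λ n → catalan m ≤ catalan n) (m∸n+n≡m m≤n) (go (n ∸ m))
  where
  go : ∀ d → catalan m ≤ catalan (d + m)
  go zero    = ≤-refl
  go (suc d) = ≤-trans (go d) (catalan-mono (d + m))

neighbour-prefix-first : ∀ n α →
  neighbour (suc (suc n)) (suc (suc n)) (prefix Fin.zero α) ≡ prefix Fin.zero (neighbour (suc n) (suc n) α)
neighbour-prefix-first n α = edge-neighbour (edge-prefix-first (edge n (suc n) (s≤s z≤n) ≤-refl α))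

neighbour-prefix-second : ∀ n α → neighbour (suc (suc (suc n))) (suc n) (prefix Fin.zero α) ≡
  prefix Fin.zero (neighbour (suc (suc n)) (suc n) α)
neighbour-prefix-second n α = edge-neighbour (edge-prefix-second (edge (suc n) (suc n) (s≤s z≤n) (n≤1+n _) α))

-- No entry measures the queue after k pops. Instead, colour k keeps the germs with a leading zero
-- among themselves, and being an involution it then keeps the others too.
entry-neighbour-first : ∀ n (α : Germ (suc (suc n))) →
  entry (string (neighbour (suc (suc n)) (suc (suc n)) α)) (suc n) ≡ entry (string α) (suc n)
entry-neighbour-first n α with head-cases n α | head-cases n (neighbour (suc (suc n)) (suc (suc n)) α)
... | inj₁ (γ , refl) | _        = trans (cong (λ β → entry (string β) (suc n)) (neighbour-prefix-first n γ))
  (trans (entry-head 0 (string (neighbour (suc n) (suc n) γ))) (sym (entry-head 0 (string γ))))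
... | inj₂ one | inj₂ one′       = trans one′ (sym one)
... | inj₂ one | inj₁ (γ , eq)   = contradiction (trans (sym one) (trans
  (cong (λ β → entry (string β) (suc n)) (trans (sym (neighbour-involutive (suc n) (suc (suc n)) (s≤s z≤n) ≤-refl α))
    (trans (cong (neighbour (suc (suc n)) (suc (suc n))) eq) (neighbour-prefix-first n γ))))
  (entry-head 0 (string (neighbour (suc n) (suc n) γ))))) λ ()

-- Columns as involutions, and sequences common to all tables

column : ∀ k p → Fin (catalan k) → Fin (catalan k)
column k p m = indexOf k (neighbour k p (germAt k m))

column-involutive : ∀ n p → 1 ≤ p → p ≤ suc n → ∀ m → column (suc n) p (column (suc n) p m) ≡ m
column-involutive n p 1≤p p≤ m = trans
  (cong (indexOf (suc n)) (trans (cong (neighbour (suc n) p) (germAt-indexOf (suc n) _)) (neighbour-involutive n p 1≤p p≤ (germAt (suc n) m))))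
  (indexOf-germAt (suc n) m)

column-permutation : ∀ n p → 1 ≤ p → p ≤ suc n → ∀ s → (∀ m → CAT (suc n) p m ≡ s m) → InvolutivePermutation (catalan (suc n)) s
column-permutation n p 1≤p p≤ s eq = permutation (column (suc n) p) (column (suc n) p) inv inv , eq , inv
  where inv = column-involutive n p 1≤p p≤

-- Tables extending one another have a limit. Its term `m` is read from the table `X m`, which by
-- `n<catalan` already has a row `m`.
module Coherent {A : Set} (X : ∀ n → Fin (catalan (suc n)) → A)
  (X-suc : ∀ n m m′ → toℕ m′ ≡ toℕ m → X (suc n) m′ ≡ X n m) where

  limit : ℕ → A
  limit m = X m (fromℕ< (n<catalan m))

  X-+ : ∀ n d m m′ → toℕ m′ ≡ toℕ m → X (d + n) m′ ≡ X n m
  X-+ n zero    m m′ eq = cong (X n) (Fin.toℕ-injective eq)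
  X-+ n (suc d) m m′ eq = trans (X-suc (d + n) m″ m′ (trans eq (sym (Fin.toℕ-fromℕ< m<)))) (X-+ n d m m″ (Fin.toℕ-fromℕ< m<))
    where
    m< : toℕ m < catalan (suc (d + n))
    m< = ≤-trans (Fin.toℕ<n m) (catalan-≤ (s≤s (m≤n+m n d)))
    m″ = fromℕ< m<

  X-≤ : ∀ {n n′} → n ≤ n′ → ∀ m m′ → toℕ m′ ≡ toℕ m → X n′ m′ ≡ X n m
  X-≤ {n} {n′} n≤n′ m = subst (λ n′ → ∀ m′ → toℕ m′ ≡ toℕ m → X n′ m′ ≡ X n m) (m∸n+n≡m n≤n′) (X-+ n (n′ ∸ n) m)

  X-limit : ∀ n m → X n m ≡ limit (toℕ m)
  X-limit n m with ≤-total n (toℕ m)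
  ... | inj₁ n≤ = sym (X-≤ n≤ m _ (Fin.toℕ-fromℕ< _))
  ... | inj₂ ≤n = X-≤ ≤n _ m (sym (Fin.toℕ-fromℕ< _))

neighbourAt-suc : ∀ n m m′ → toℕ m′ ≡ toℕ m →
  neighbour (suc (suc n)) (suc (suc n)) (germAt (suc (suc n)) m′) ≡
  prefix Fin.zero (neighbour (suc n) (suc n) (germAt (suc n) m))
neighbourAt-suc n m m′ eq = trans (cong (neighbour (suc (suc n)) (suc (suc n))) (germAt-prefix n m m′ eq)) (neighbour-prefix-first n (germAt (suc n) m))

module RGS = Coherent (λ n m → rgs (neighbour (suc n) (suc n) (germAt (suc n) m)))
  -- `rgs` discards the prefixed zero by computation.
  (λ n m m′ eq → cong rgs (neighbourAt-suc n m m′ eq))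

module First = Coherent (λ n → CAT (suc n) (suc n))
  (λ n m m′ eq → trans (cong (toℕ ∘ indexOf (suc (suc n))) (neighbourAt-suc n m m′ eq)) (indexOf-prefix n _))

-- The sequence assembled from the parts, and how they determine the columns

-- The k-th part is written with k = i + 2.
Part : ℕ → Set
Part m = ∃[ i ] partStart (suc (suc i)) ≤ m × m < catalan (suc (suc i))

part : ∀ m n → m < catalan (suc (suc n)) → Part m
part m zero    m< = 0 , z≤n , m<
part m (suc n) m< with ≤-<-connex (catalan (suc (suc n))) m
... | inj₁ ≤m  = suc n , ≤m , m<
... | inj₂ m<′ = part m n m<′

part-unique : ∀ {m} i i′ → partStart (suc (suc i)) ≤ m → m < catalan (suc (suc i)) →
  partStart (suc (suc i′)) ≤ m → m < catalan (suc (suc i′)) → i ≡ i′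
part-unique i i′ s≤ <c s≤′ <c′ = ≤-antisym (disjoint i i′ s≤ <c′) (disjoint i′ i s≤′ <c)
  where
  disjoint : ∀ {m} i i′ → partStart (suc (suc i)) ≤ m → m < catalan (suc (suc i′)) → i ≤ i′
  disjoint zero    i′ _  _  = z≤n
  disjoint (suc i) i′ s≤ <c = ≮⇒≥ λ i′< → <-irrefl refl (≤-trans <c (≤-trans (catalan-≤ (s≤s (i′<))) s≤))

preserves : ∀ k → 1 < k → ∀ i → ((1 ≤ i × i ≤ k ∸ 1) ⊎ i ≡ k + 1) → (α : Germ k) →
  entry (string (neighbour k (i ∸ 1) α)) (j k (i ∸ 1)) ≡ entry (string α) (j k (i ∸ 1))
preserves (suc n) 1<k (suc p) (inj₁ (_ , p<n)) α with p ≟ suc n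
... | yes refl = contradiction p<n (<⇒≱ (m≤n⇒m≤1+n ≤-refl))
... | no  _    = entry-neighbour n p p<n α
preserves (suc (suc n)) _ _ (inj₂ refl) α rewrite +-comm n 1 with suc (suc n) ≟ suc (suc n)
... | yes _   = entry-neighbour-first n α
... | no  k≢k = contradiction refl k≢k
preserves (suc zero) (s≤s ())

CAT-at : ∀ {m} → Part m → ℕ
CAT-at (i , _ , m<) = CAT (suc (suc i)) (suc i) (fromℕ< m<)

CAT-at-≡ : ∀ {i i′} → i ≡ i′ → ∀ m s≤ m< → CAT (suc (suc i)) (suc i) m ≡ CAT-at {toℕ m} (i′ , s≤ , m<)
CAT-at-≡ {i} refl m _ m< = cong (CAT (suc (suc i)) (suc i)) (sym (Fin.fromℕ<-toℕ m m<))

CAT-at-unique : ∀ i m → partStart (suc (suc i)) ≤ toℕ m → (P : Part (toℕ m)) → CAT (suc (suc i)) (suc i) m ≡ CAT-at P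
CAT-at-unique i m s≤ (i′ , s≤′ , m<′) = CAT-at-≡ (part-unique i i′ s≤ (Fin.toℕ<n m) s≤′ m<′) m s≤′ m<′

part-of : ∀ m → Part m
part-of m = part m m (≤-trans (n<catalan m) (catalan-mono (suc m)))

part-limit : ℕ → ℕ
part-limit m = CAT-at (part-of m)

CAT-part : ∀ i m → partStart (suc (suc i)) ≤ toℕ m → CAT (suc (suc i)) (suc i) m ≡ part-limit (toℕ m)
CAT-part i m s≤ = CAT-at-unique i m s≤ (part-of (toℕ m))

second-column-high : ∀ n m → toℕ m < catalan (suc n) → catalan (suc n) ≤ toℕ (column (suc (suc n)) (suc n) m)
second-column-high n m m< = index-head n _ (second-colour-entry
  (subst (λ α → Edge (suc n) (suc n) α (neighbour (suc (suc n)) (suc n) (germAt (suc (suc n)) m)))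
    (germAt-prefix n (fromℕ< m<) m (sym (Fin.toℕ-fromℕ< m<)))
    (edge (suc n) (suc n) (s≤s z≤n) (n≤1+n (suc n)) (germAt (suc (suc n)) m))))

-- For a low `m` the element `c m` is high, where `π` is known: it sends `c m` to `m`, and being an
-- involution it sends `m` to `c m`.
involution-determined : ∀ {N} lo (c : Fin N → Fin N) → (∀ m → c (c m) ≡ m) →
  (∀ m → toℕ m < lo → lo ≤ toℕ (c m)) → (π : Permutation′ N) → Involutive π →
  (∀ m → lo ≤ toℕ m → toℕ (π ⟨$⟩ʳ m) ≡ toℕ (c m)) → ∀ m → toℕ (π ⟨$⟩ʳ m) ≡ toℕ (c m)
involution-determined lo c c-inv high π π-inv agree m with ≤-<-connex lo (toℕ m)
... | inj₁ ≤m = agree m ≤m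
... | inj₂ m< = cong toℕ (trans
  (cong (π ⟨$⟩ʳ_) (sym (Fin.toℕ-injective (trans (agree (c m) (high m m<)) (cong toℕ (c-inv m))))))
  (π-inv (c m)))

determined : ∀ n (π : Permutation′ (catalan (suc (suc n)))) → Involutive π →
  (∀ m → partStart (suc (suc n)) ≤ toℕ m → toℕ (π ⟨$⟩ʳ m) ≡ CAT (suc (suc n)) (suc n) m) →
  ∀ m → toℕ (π ⟨$⟩ʳ m) ≡ CAT (suc (suc n)) (suc n) m
-- For k = 2 the part starts at row 0 and is the whole column.
determined zero    π inv agree m = agree m z≤n
determined (suc n) π inv agree m = involution-determined (catalan (suc (suc n))) (column (suc (suc (suc n))) (suc (suc n)))
  (column-involutive (suc (suc n)) (suc (suc n)) (s≤s z≤n) (n≤1+n (suc (suc n)))) (second-column-high (suc n)) π inv agree m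

CAT-second-suc : ∀ n m m′ → toℕ m′ ≡ toℕ m → CAT (suc (suc (suc n))) (suc n) m′ ≡ CAT (suc (suc n)) (suc n) m
CAT-second-suc n m m′ eq = trans
  (cong (toℕ ∘ indexOf (suc (suc (suc n)))) (trans (cong (neighbour (suc (suc (suc n))) (suc n)) (germAt-prefix (suc n) m m′ eq))
    (neighbour-prefix-second n (germAt (suc (suc n)) m))))
  (indexOf-prefix (suc n) (neighbour (suc (suc n)) (suc n) (germAt (suc (suc n)) m)))

theorem14 :
  -- (A)
  (∀ k → 1 < k → ∀ i → ((1 ≤ i × i ≤ k ∸ 1) ⊎ i ≡ k + 1) → (α : Germ k) →
    entry (string (neighbour k (i ∸ 1) α)) (j k (i ∸ 1)) ≡ entry (string α) (j k (i ∸ 1)))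
  ×
  -- (B)
  (Σ[ R ∈ (ℕ → List ℕ) ] Σ[ S₀ ∈ (ℕ → ℕ) ]
    (∀ k → 1 < k → (m : Fin (catalan k)) → rgs (neighbour k k (germAt k m)) ≡ R (toℕ m)) ×
    (∀ k → 1 < k → (m : Fin (catalan k)) → CAT k k m ≡ S₀ (toℕ m)) ×
    (∀ k → 1 < k → InvolutivePermutation (catalan k) (λ m → S₀ (toℕ m))))
  ×
  -- (C)
  (Σ[ S₁ ∈ (ℕ → ℕ) ]
    (∀ k → 1 < k → (m : Fin (catalan k)) → partStart k ≤ toℕ m → CAT k (k ∸ 1) m ≡ S₁ (toℕ m)) ×
    (∀ k → 1 < k → (π : Permutation′ (catalan k)) → Involutive π →
      (∀ m → partStart k ≤ toℕ m → toℕ (π ⟨$⟩ʳ m) ≡ S₁ (toℕ m)) →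
      ∀ m → toℕ (π ⟨$⟩ʳ m) ≡ CAT k (k ∸ 1) m))
  ×
  -- (D)
  (∀ k → 1 < k →
    InvolutivePermutation (catalan k) (CAT k (k ∸ 1)) ×
    (∀ m → CAT k (k ∸ 1) m ≡ CAT (suc k) (k ∸ 1) (inject≤ m (catalan-mono k))))
theorem14 =
  preserves ,
  (RGS.limit , First.limit ,
    (λ { (suc n) _ → RGS.X-limit n }) ,
    (λ { (suc n) _ → First.X-limit n }) ,
    (λ { (suc n) _ → column-permutation n (suc n) (s≤s z≤n) ≤-refl _ (First.X-limit n) })) ,
  (part-limit ,
    (λ { (suc (suc n)) _ → CAT-part n ; (suc zero) (s≤s ()) }) ,
    (λ { (suc (suc n)) _ π inv agree → determined n π inv λ m ≤m → trans (agree m ≤m) (sym (CAT-part n m ≤m))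
       ; (suc zero) (s≤s ()) })) ,
  λ { (suc (suc n)) _ →
        column-permutation (suc n) (suc n) (s≤s z≤n) (n≤1+n _) _ (λ _ → refl) ,
        λ m → sym (CAT-second-suc n m _ (Fin.toℕ-inject≤ m _))
    ; (suc zero) (s≤s ()) }
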